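{- Let $k$ and $m$ be positive integers. Let $G$ be a $k$-connected graph with \[ \delta(G)\ge \max\{k+1,2m-2\}. \] Then $G$ contains a $k$-removable matching of size $m$, unless $G\cong K_{2m-1}$, or $(k,m)=(1,2)$ and $G$ is a cycle.
   Context: All graphs are finite, undirected and simple. $\delta(G)$ is the minimum degree of $G$. A graph is $k$-connected in the usual sense: it has more than $k$ vertices and deleting any set of fewer than $k$ vertices leaves a connected graph. For a $k$-connected graph $G$, a matching $M\subseteq E(G)$ (a set of pairwise vertex-disjoint edges) is called $k$-removable if the graph $G-M$, obtained from $G$ by deleting the edges in $M$ (keeping all vertices), is $k$-connected. The size of a matching is its number of edges. -}

module Defs where

open import Level using (0ℓ)
open import Data.Nat using (ℕ; suc; _+_; _<_; _>_; _%_)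
open import Data.Nat.Properties using (m≤n⇒m<n∨m≡n; 1+n≢n ; 1+n≢0; suc-injective) renaming (_≟_ to _≟ℕ_)
open import Data.Nat.DivMod using (m<n⇒m%n≡m; n%n≡0)
open import Data.Fin using (Fin; toℕ)
open import Data.Fin.Properties using (_≟_; toℕ<n)
open import Data.Fin.Subset using (Subset; _∉_; ∣_∣)
open import Data.List using (List; length; map; filter; allFin)
open import Data.List.Extrema.Nat using (min)
open import Data.List.Relation.Unary.All using (All)
open import Data.List.Relation.Unary.AllPairs using (AllPairs)
open import Data.List.Membership.Propositional using (_∈_)
import Data.List.Membership.DecPropositional as DecMembership
open import Data.Product using (∃; _×_; _,_; proj₁)
open import Data.Product.Properties using (≡-dec)
open import Data.Sum using (_⊎_; inj₁; inj₂; swap)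
open import Function using (_∘_)
open import Function.Bundles using (_↔_; _⇔_; Inverse)
open import Relation.Binary using (Rel; Decidable; Symmetric)
open import Relation.Binary.Construct.Closure.ReflexiveTransitive using (Star)
open import Relation.Binary.PropositionalEquality using (_≡_; _≢_; refl; sym; trans; cong)
open import Relation.Nullary using (¬_; ¬?; _×-dec_; _⊎-dec_)

record Graph (V : Set) : Set₁ where
  field
    Adj    : Rel V 0ℓ
    adj?   : Decidable Adj
    symm   : Symmetric Adj
    irrefl : ∀ {v} → ¬ Adj v v

open Graph public

record _≅_ {V W : Set} (G : Graph V) (H : Graph W) : Set where
  field
    vertices : V ↔ W
    adjacent : ∀ u v → Adj G u v ⇔ Adj H (Inverse.to vertices u) (Inverse.to vertices v)

infix 4 _≅_

deg : ∀ {n} → Graph (Fin n) → Fin n → ℕ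
deg {n} G v = length (filter (adj? G v) (allFin n))

-- `min n` includes the default value n in the minimum; every degree is
-- smaller than n, so the default only matters for the empty graph.
δ : ∀ {n} → Graph (Fin n) → ℕ
δ {n} G = min n (map (deg G) (allFin n))

Connected : {V : Set} → Graph V → Set
Connected G = ∀ u v → Star (Adj G) u v

-- Negation is definitionally proof-irrelevant in the library, so this graph has
-- exactly one vertex for each v outside S.
_-ᵛ_ : ∀ {n} → Graph (Fin n) → (S : Subset n) → Graph (∃ λ v → v ∉ S)
G -ᵛ S = record
  { Adj    = λ u v → Adj G (proj₁ u) (proj₁ v)
  ; adj?   = λ u v → adj? G (proj₁ u) (proj₁ v)
  ; symm   = symm G
  ; irrefl = irrefl G
  }

_-connected_ : ∀ {n} → ℕ → Graph (Fin n) → Set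
_-connected_ {n} k G = n > k × (∀ (S : Subset n) → ∣ S ∣ < k → Connected (G -ᵛ S))

-- A set of edges is given by a list of pairs, where (u , v) and (v , u)
-- both stand for the edge uv.
Edges : ℕ → Set
Edges n = List (Fin n × Fin n)

_—_∈ᴱ_ : ∀ {n} → Fin n → Fin n → Edges n → Set
u — v ∈ᴱ M = (u , v) ∈ M ⊎ (v , u) ∈ M

VertexDisjoint : ∀ {n} → Rel (Fin n × Fin n) 0ℓ
VertexDisjoint (u , v) (x , y) = u ≢ x × u ≢ y × v ≢ x × v ≢ y

-- Vertex-disjoint edges are distinct, so a matching has no repeated
-- entries and its number of edges is the length of the list.
IsMatching : ∀ {n} → Graph (Fin n) → Edges n → Set
IsMatching G M = All (λ (u , v) → Adj G u v) M × AllPairs VertexDisjoint M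

size : ∀ {n} → Edges n → ℕ
size = length

_-ᵉ_ : ∀ {n} → Graph (Fin n) → Edges n → Graph (Fin n)
G -ᵉ M = record
  { Adj    = λ u v → Adj G u v × ¬ (u — v ∈ᴱ M)
  ; adj?   = λ u v → adj? G u v ×-dec ¬? (((u , v) ∈? M) ⊎-dec ((v , u) ∈? M))
  ; symm   = λ (a , ¬e) → symm G a , ¬e ∘ swap
  ; irrefl = irrefl G ∘ proj₁
  }
  where open DecMembership (≡-dec _≟_ _≟_) using (_∈?_)

_-removable : ℕ → ∀ {n} → Graph (Fin n) → Edges n → Set
(k -removable) G M = IsMatching G M × k -connected (G -ᵉ M)

K : ∀ n → Graph (Fin n)
K n = record
  { Adj    = _≢_
  ; adj?   = λ u v → ¬? (u ≟ v)
  ; symm   = λ u≢v → u≢v ∘ sym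
  ; irrefl = λ v≢v → v≢v refl
  }

Next : ∀ {r} → Rel (Fin (3 + r)) 0ℓ
Next {r} u v = toℕ v ≡ suc (toℕ u) % (3 + r)

Next-irrefl : ∀ {r} {v : Fin (3 + r)} → ¬ Next v v
Next-irrefl {r} {v} eq with m≤n⇒m<n∨m≡n (toℕ<n v)
... | inj₁ lt = 1+n≢n (sym (trans eq (m<n⇒m%n≡m lt)))
... | inj₂ e  = 1+n≢0 (sym (trans (sym v≡0) (suc-injective e)))
  where
  v≡0 : toℕ v ≡ 0
  v≡0 = trans eq (trans (cong (_% (3 + r)) e) (n%n≡0 (3 + r)))

-- The cycle of length 3 + r.
C : ∀ r → Graph (Fin (3 + r))
C r = record
  { Adj    = λ u v → Next u v ⊎ Next v u
  ; adj?   = λ u v → next? u v ⊎-dec next? v u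
  ; symm   = swap
  ; irrefl = λ { (inj₁ e) → Next-irrefl e ; (inj₂ e) → Next-irrefl e }
  }
  where
  next? : Decidable (Next {r})
  next? u v = toℕ v ≟ℕ suc (toℕ u) % (3 + r)

IsCycle : ∀ {n} → Graph (Fin n) → Set
IsCycle G = ∃ λ r → G ≅ C r

{-# OPTIONS --safe #-}
-- A separation of G that becomes one of order below k once the edge xy is deleted is recorded by
-- two disjoint sets A ∋ x and B ∋ y joined by xy alone. Uncrossing two such pairs at consecutive
-- non-removable edges xy, yz with deg y > k shows that the side beyond yz is smaller than the
-- side beyond xy. Hence (Mader) the non-removable edges between vertices of degree above k form a
-- forest.
--
-- Let M be a removable matching that cannot be enlarged, with U the set of vertices it leaves
-- uncovered: then G[U] is a forest, and counting degrees at a vertex with at most one neighbour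
-- in U (a tip) gives |M| ≥ m - 1. If |M| = m - 1 and U is a single vertex, then G = K_{2m-1}.
-- Otherwise there are two tips u and v, each missing at most one vertex of M, and one replaces
-- some xy ∈ M by uy and vx. After xy is restored, an edge from a tip to an end of an edge of M
-- whose two ends it sees is again removable, which suffices unless v misses y; in that case
-- exchanging xy for uy first yields the contradiction.
--
-- The remaining case k = 1, m = 2 is settled by a longest path: deleting its two end edges keeps
-- G connected unless its ends are adjacent, and then the path closes up to a Hamiltonian cycle
-- without chords.
module Submission where

open import Defs
open import Data.Nat using (ℕ; zero; suc; _+_; _*_; _∸_; _⊔_; _≤_; _<_; _≥_; z≤n; s≤s; s≤s⁻¹; _≤?_; _<?_; _≤′_; ≤′-refl; ≤′-step; _%_; _/_)
open import Data.Nat.Properties renaming (_≟_ to _≟ℕ_)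
open import Algebra.Solver.CommutativeMonoid +-0-commutativeMonoid using (_⊕_; _⊜_) renaming (solve to linear; id to unit)
open import Data.Bool using (true; false)
open import Data.Nat.DivMod using (m%n<n; n%n≡0; m<n⇒m%n≡m; [m+n]%n≡m%n; [m+kn]%n≡m%n; m≡m%n+[m/n]*n)
open import Data.Fin using (Fin; zero; suc; toℕ; fromℕ<)
open import Data.Fin.Properties using (_≟_; any?; all?; toℕ<n; toℕ-fromℕ<; toℕ-injective; injective⇒≤)
open import Data.Fin.Subset renaming (⊥ to ∅ˢ; ⊤ to ⊤ˢ; ⁅_⁆ to ⟨_⟩)
open import Data.Fin.Subset.Properties
open import Data.List using (List; []; _∷_; length; filter; map; allFin; tabulate)
open import Data.List.Extrema.Nat using (min≤xs)
open import Data.List.Membership.Propositional.Properties using (∈-map⁺; ∈-allFin)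
open import Data.List.Relation.Unary.All as All using (All; []; _∷_)
open import Data.List.Relation.Unary.AllPairs using (AllPairs; []; _∷_)
open import Data.List.Relation.Unary.Any using (here; there)
open import Data.List.Membership.Propositional using () renaming (_∈_ to _∈ᴸ_)
import Data.Vec as Vec
import Data.Vec.Properties as Vec
open import Data.Product using (∃; ∃₂; _×_; _,_; proj₁; proj₂)
open import Data.Sum using (_⊎_; inj₁; inj₂; [_,_]′)
open import Data.Empty using (⊥; ⊥-elim)
open import Data.Unit using (⊤; tt)
open import Function using (_∘_; id)
open import Function.Bundles using (mk⇔; mk↔ₛ′)
open import Relation.Binary.Construct.Closure.ReflexiveTransitive using (Star; ε; _◅_; _◅◅_) renaming (reverse to Star-reverse)
open import Relation.Binary.PropositionalEquality using (_≡_; _≢_; refl; sym; trans; cong; cong₂; subst; subst₂)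
open import Relation.Nullary using (¬_; Dec; yes; no; does; ¬?; _×-dec_; _→-dec_; contradiction)
import Relation.Nullary.Decidable as Dec
open import Relation.Unary using (Decidable)

private variable
  n : ℕ

-- Finite sets of vertices and their sizes

Disjoint : (A B : Subset n) → Set
Disjoint A B = ∀ v → v ∈ A → v ∉ B

Disjoint-sym : {A B : Subset n} → Disjoint A B → Disjoint B A
Disjoint-sym d v b a = d v a b

comprehension : {P : Fin n → Set} → Decidable P → Subset n
comprehension P? = Vec.tabulate (does ∘ P?)

∈-comprehension⁺ : {P : Fin n → Set} (P? : Decidable P) {v : Fin n} → P v → v ∈ comprehension P?
∈-comprehension⁺ P? {v} p = Vec.lookup⇒[]= v _ (trans (Vec.lookup∘tabulate (does ∘ P?) v) (Dec.dec-true (P? v) p))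

∈-comprehension⁻ : {P : Fin n → Set} (P? : Decidable P) {v : Fin n} → v ∈ comprehension P? → P v
∈-comprehension⁻ P? {v} i with P? v | trans (sym (Vec.lookup∘tabulate (does ∘ P?) v)) (Vec.[]=⇒lookup i)
... | yes p | _ = p
... | no _  | ()

∪-∩-size : (p q : Subset n) → ∣ p ∪ q ∣ + ∣ p ∩ q ∣ ≡ ∣ p ∣ + ∣ q ∣
∪-∩-size Vec.[] Vec.[] = refl
∪-∩-size (true  Vec.∷ p) (true  Vec.∷ q) = cong suc (trans (+-suc _ _) (trans (cong suc (∪-∩-size p q)) (sym (+-suc _ _))))
∪-∩-size (true  Vec.∷ p) (false Vec.∷ q) = cong suc (∪-∩-size p q)
∪-∩-size (false Vec.∷ p) (true  Vec.∷ q) = trans (cong suc (∪-∩-size p q)) (sym (+-suc _ _))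
∪-∩-size (false Vec.∷ p) (false Vec.∷ q) = ∪-∩-size p q

∪-size-≤ : (p q : Subset n) → ∣ p ∪ q ∣ ≤ ∣ p ∣ + ∣ q ∣
∪-size-≤ p q = ≤-trans (m≤m+n _ _) (≤-reflexive (∪-∩-size p q))

Empty-size : {p : Subset n} → (∀ v → v ∉ p) → ∣ p ∣ ≡ 0
Empty-size {n} {p} e = trans (cong ∣_∣ (Empty-unique {p = p} λ (v , i) → e v i)) (∣⊥∣≡0 n)

∪-size-disjoint : (p q : Subset n) → Disjoint p q → ∣ p ∪ q ∣ ≡ ∣ p ∣ + ∣ q ∣
∪-size-disjoint p q d = trans (sym (trans (cong (∣ p ∪ q ∣ +_) (Empty-size λ v i →
  let a , b = x∈p∩q⁻ p q i in d v a b)) (+-identityʳ _))) (∪-∩-size p q)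

∁-size : (p : Subset n) → ∣ p ∣ + ∣ ∁ p ∣ ≡ n
∁-size p = trans (cong (∣ p ∣ +_) (∣∁p∣≡n∸∣p∣ p)) (m+[n∸m]≡n (∣p∣≤n p))

∈-─⁻ : (p q : Subset n) {v : Fin n} → v ∈ p ─ q → v ∈ p × v ∉ q
∈-─⁻ p q {v} i = p─q⊆p p q i , λ j → nope p q j i
  where
  nope : ∀ {n} (p q : Subset n) {v} → v ∈ q → v ∉ p ─ q
  nope (_ Vec.∷ p) (_ Vec.∷ q) (Vec.there j) (Vec.there i) = nope p q j i
  nope (true Vec.∷ p) (true Vec.∷ q) Vec.here ()
  nope (false Vec.∷ p) (true Vec.∷ q) Vec.here ()

∈-delete⁻ : (p : Subset n) {x v : Fin n} → v ∈ p - x → v ∈ p × v ≢ x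
∈-delete⁻ p {x} i = let a , b = ∈-─⁻ p ⟨ x ⟩ i in a , x∉⁅y⁆⇒x≢y b

delete-size : (p : Subset n) {x : Fin n} → ∣ p ∣ ≤ suc ∣ p - x ∣
delete-size p {x} = ≤-trans (p⊆q⇒∣p∣≤∣q∣ sub) (≤-trans (∪-size-≤ ⟨ x ⟩ (p - x)) (≤-reflexive (cong (_+ ∣ p - x ∣) (∣⁅x⁆∣≡1 x))))
  where
  sub : p ⊆ ⟨ x ⟩ ∪ (p - x)
  sub {v} i with v ≟ x
  ... | yes refl = x∈p∪q⁺ (inj₁ (x∈⁅x⁆ x))
  ... | no ne    = x∈p∪q⁺ (inj₂ (x∈p∧x≢y⇒x∈p-y i ne))

∈-size : {p : Subset n} {x : Fin n} → x ∈ p → 1 ≤ ∣ p ∣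
∈-size {x = x} i = ≤-trans (≤-reflexive (sym (∣⁅x⁆∣≡1 x)))
  (p⊆q⇒∣p∣≤∣q∣ λ j → subst (_∈ _) (sym (x∈⁅y⁆⇒x≡y x j)) i)

size-nonempty : {p : Subset n} → 1 ≤ ∣ p ∣ → Nonempty p
size-nonempty {p = p} h with nonempty? p
... | yes e = e
... | no ¬e = contradiction (subst (1 ≤_) (Empty-size λ v i → ¬e (v , i)) h) λ ()

pair-size : (x y : Fin n) → ∣ ⟨ x ⟩ ∪ ⟨ y ⟩ ∣ ≤ 2
pair-size x y = ≤-trans (∪-size-≤ ⟨ x ⟩ ⟨ y ⟩) (≤-reflexive (cong₂ _+_ (∣⁅x⁆∣≡1 x) (∣⁅x⁆∣≡1 y)))

≢-pair-size : {p : Subset n} {x y : Fin n} → x ∈ p → y ∈ p → x ≢ y → 2 ≤ ∣ p ∣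
≢-pair-size {p = p} {x} {y} i j ne = ≤-trans (≤-reflexive (sym (cong₂ _+_ (∣⁅x⁆∣≡1 x) (∣⁅x⁆∣≡1 y))))
  (≤-trans (≤-reflexive (sym (∪-size-disjoint ⟨ x ⟩ ⟨ y ⟩ dis))) (p⊆q⇒∣p∣≤∣q∣ sub))
  where
  dis : Disjoint ⟨ x ⟩ ⟨ y ⟩
  dis v a b = ne (trans (sym (x∈⁅y⁆⇒x≡y x a)) (x∈⁅y⁆⇒x≡y y b))
  sub : ⟨ x ⟩ ∪ ⟨ y ⟩ ⊆ p
  sub m with x∈p∪q⁻ ⟨ x ⟩ ⟨ y ⟩ m
  ... | inj₁ e = subst (_∈ p) (sym (x∈⁅y⁆⇒x≡y x e)) i
  ... | inj₂ e = subst (_∈ p) (sym (x∈⁅y⁆⇒x≡y y e)) j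

-- Transfers an inequality along an identity between linear expressions.
≤-from : ∀ {a b l r} → l ≤ r → a + r ≡ b + l → a ≤ b
≤-from {a} {b} {l} {r} h e = +-cancelʳ-≤ r a b (≤-trans (≤-reflexive e) (+-monoʳ-≤ b h))

-- Neighbourhoods, separated pairs and connectivity

nbhd : Graph (Fin n) → Fin n → Subset n
nbhd H v = comprehension (adj? H v)

nbhd-size : (H : Graph (Fin n)) (v : Fin n) → ∣ nbhd H v ∣ ≡ deg H v
nbhd-size H v = sym (go id)
  where
  go : ∀ {m} (f : Fin m → Fin _) → length (filter (adj? H v) (tabulate f)) ≡ ∣ Vec.tabulate (λ i → does (adj? H v (f i))) ∣
  go {zero}  f = refl
  go {suc m} f with adj? H v (f zero)
  ... | yes _ = cong suc (go (f ∘ suc))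
  ... | no  _ = go (f ∘ suc)

module _ (H : Graph (Fin n)) {v u : Fin n} where
  ∈-nbhd⁺ : Adj H v u → u ∈ nbhd H v
  ∈-nbhd⁺ = ∈-comprehension⁺ (adj? H v)

  ∈-nbhd⁻ : u ∈ nbhd H v → Adj H v u
  ∈-nbhd⁻ = ∈-comprehension⁻ (adj? H v)

NoEdge : Graph (Fin n) → (A B : Subset n) → Set
NoEdge H A B = ∀ u v → u ∈ A → v ∈ B → ¬ Adj H u v

-- k-connectedness in terms of pairs of separated sets; the sets are not
-- required to cover the vertices outside the separator.
record Inseparable (k : ℕ) (H : Graph (Fin n)) : Set where
  field
    order : k < n
    cut   : ∀ A B → Nonempty A → Nonempty B → Disjoint A B → NoEdge H A B → ∣ A ∣ + ∣ B ∣ + k ≤ n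

open Inseparable

-- When xy is an edge of a k-connected H, this says that H minus xy is no longer k-connected.
record Tight (k : ℕ) (H : Graph (Fin n)) (x y : Fin n) (A B : Subset n) : Set where
  field
    left     : x ∈ A
    right    : y ∈ B
    disjoint : Disjoint A B
    only     : ∀ u v → u ∈ A → v ∈ B → Adj H u v → u ≡ x × v ≡ y
    large    : suc n ≤ ∣ A ∣ + ∣ B ∣ + k

open Tight

Tight-sym : ∀ {k} {H : Graph (Fin n)} {x y A B} → Tight k H x y A B → Tight k H y x B A
Tight-sym {n} {k} {H} {A = A} {B} t = record
  { left = right t ; right = left t ; disjoint = Disjoint-sym (disjoint t)
  ; only = λ u v i j e → let a , b = only t v u j i (symm H e) in b , a
  ; large = subst (λ z → suc n ≤ z + k) (+-comm (∣ A ∣) (∣ B ∣)) (large t) }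

disjoint? : (A B : Subset n) → Dec (Disjoint A B)
disjoint? A B = Dec.map′ (λ f v a b → f v (a , b)) (λ d v (a , b) → d v a b)
  (all? λ v → ¬? ((v ∈? A) ×-dec (v ∈? B)))

noEdge? : (H : Graph (Fin n)) (A B : Subset n) → Dec (NoEdge H A B)
noEdge? H A B = Dec.map′ (λ f u v a b e → f u v (a , b , e)) (λ d u v (a , b , e) → d u v a b e)
  (all? λ u → all? λ v → ¬? ((u ∈? A) ×-dec (v ∈? B) ×-dec adj? H u v))

-- Running through the finitely many pairs of subsets lets the argument split constructively on
-- whether deleting an edge is harmful.
tight? : (k : ℕ) (H : Graph (Fin n)) (x y : Fin n) → Dec (∃₂ λ A B → Tight k H x y A B)
tight? {n} k H x y = anySubset? λ A → anySubset? λ B →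
  Dec.map′ (λ (a , b , c , d , e) → record { left = a ; right = b ; disjoint = c
                ; only = λ u v i j h → d u v (i , j , h) ; large = e })
           (λ t → left t , right t , disjoint t , (λ u v (i , j , h) → only t u v i j h) , large t)
  ((x ∈? A) ×-dec (y ∈? B) ×-dec disjoint? A B ×-dec
   (all? λ u → all? λ v → ((u ∈? A) ×-dec (v ∈? B) ×-dec adj? H u v) →-dec ((u ≟ x) ×-dec (v ≟ y)))
   ×-dec (suc n ≤? ∣ A ∣ + ∣ B ∣ + k))

inseparable? : (k : ℕ) (H : Graph (Fin n)) → Dec (Inseparable k H)
inseparable? {n} k H = Dec.map′
  (λ (o , f) → record { order = o ; cut = λ A B a b d e → ≮⇒≥ λ h → f (A , B , a , b , d , e , h) })
  (λ I → order I , λ (A , B , a , b , d , e , h) → <⇒≱ h (cut I A B a b d e))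
  ((k <? n) ×-dec ¬? (anySubset? λ A → anySubset? λ B → nonempty? A ×-dec nonempty? B ×-dec
     disjoint? A B ×-dec noEdge? H A B ×-dec (n <? ∣ A ∣ + ∣ B ∣ + k)))

partition-size : (A B : Subset n) → Disjoint A B → ∣ A ∣ + ∣ B ∣ + ∣ ∁ (A ∪ B) ∣ ≡ n
partition-size A B d = trans (cong (_+ ∣ ∁ (A ∪ B) ∣) (sym (∪-size-disjoint A B d))) (∁-size (A ∪ B))

∈-outside⁺ : (A B : Subset n) {v : Fin n} → v ∉ A → v ∉ B → v ∈ ∁ (A ∪ B)
∈-outside⁺ A B a b = x∉p⇒x∈∁p λ i → [ a , b ]′ (x∈p∪q⁻ A B i)

∈-outside⁻ : (A B : Subset n) {v : Fin n} → v ∈ ∁ (A ∪ B) → v ∉ A × v ∉ B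
∈-outside⁻ A B i = (λ a → x∈∁p⇒x∉p i (x∈p∪q⁺ (inj₁ a))) , (λ b → x∈∁p⇒x∉p i (x∈p∪q⁺ {p = A} (inj₂ b)))

-- If fewer than `k` vertices lay outside `A ∪ B`, a walk avoiding them would lead from `A` to `B`;
-- but with no edge from `A` to `B` it can never leave `A`.
connected⇒inseparable : ∀ {k} {G : Graph (Fin n)} → k -connected G → Inseparable k G
connected⇒inseparable {n} {k} {G} (o , conn) = record { order = o ; cut = c }
  where
  c : ∀ A B → Nonempty A → Nonempty B → Disjoint A B → NoEdge G A B → ∣ A ∣ + ∣ B ∣ + k ≤ n
  c A B (a , a∈A) (b , b∈B) d ne with ∣ ∁ (A ∪ B) ∣ <? k
  ... | no ≮ = ≤-trans (+-monoʳ-≤ (∣ A ∣ + ∣ B ∣) (≮⇒≥ ≮)) (≤-reflexive (partition-size A B d))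
  ... | yes small = ⊥-elim (d b (stay (conn S small (a , λ i → proj₁ (∈-outside⁻ A B i) a∈A)
                                                    (b , λ i → proj₂ (∈-outside⁻ A B i) b∈B)) a∈A) b∈B)
    where
    S = ∁ (A ∪ B)
    stay : ∀ {u v} → Star (Adj (G -ᵛ S)) u v → proj₁ u ∈ A → proj₁ v ∈ A
    stay ε i = i
    stay (_◅_ {_} {w , w∉S} e es) i with w ∈? A
    ... | yes j = stay es j
    ... | no ¬j with w ∈? B
    ... | yes j  = contradiction e (ne _ w i j)
    ... | no ¬j′ = contradiction (∈-outside⁺ A B ¬j ¬j′) w∉S

-- The set `R` of vertices known to be reachable from `u` grows by one vertex at a time until it
-- contains `v`; `fuel` bounds the number of vertices still missing.
inseparable⇒connected : ∀ {k} {G : Graph (Fin n)} → Inseparable k G → k -connected G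
inseparable⇒connected {n} {k} {G} I = order I , conn
  where
  conn : ∀ S → ∣ S ∣ < k → Connected (G -ᵛ S)
  conn S small u v = grow n ⟨ proj₁ u ⟩ (m≤m+n n _) (proj₁ u , x∈⁅x⁆ _)
      (λ w i → λ j → proj₂ u (subst (_∈ S) (x∈⁅y⁆⇒x≡y _ i) j))
      (λ w i w∉S → subst-end (sym (x∈⁅y⁆⇒x≡y _ i)) w∉S)
    where
    subst-end : ∀ {w} → proj₁ u ≡ w → (w∉S : w ∉ S) → Star (Adj (G -ᵛ S)) u (w , w∉S)
    subst-end refl _ = ε

    grow : ∀ fuel (R : Subset n) → n ≤ fuel + ∣ R ∣ → Nonempty R → Disjoint R S →
           (∀ w → w ∈ R → (w∉S : w ∉ S) → Star (Adj (G -ᵛ S)) u (w , w∉S)) → Star (Adj (G -ᵛ S)) u v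
    grow fuel R h ne d r with proj₁ v ∈? R
    ... | yes i = r _ i (proj₂ v)
    ... | no ∉R with any? (λ a → any? λ b → (a ∈? R) ×-dec (b ∈? ∁ (R ∪ S)) ×-dec adj? G a b)
    -- No edge leads from `R` to the remaining vertices `B`, so these two sets form a cut with
    -- separator `S`, which forces `k ≤ ∣ S ∣`.
    ... | no ¬e = contradiction (+-cancelˡ-≤ (∣ R ∣ + ∣ B ∣) _ _ (≤-trans
              (cut I R B ne (proj₁ v , ∈-outside⁺ R S ∉R (proj₂ v)) (λ w i j → proj₁ (∈-outside⁻ R S j) i)
                     (λ a b i j e → ¬e (a , b , i , j , e)))
              (≤-reflexive (trans (sym (partition-size R S d)) (swap (∣ R ∣) (∣ S ∣) (∣ B ∣)))))) (<⇒≱ small)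
      where
      B = ∁ (R ∪ S)
      swap : ∀ a b c → a + b + c ≡ a + c + b
      swap a b c = linear 4 (λ a b c o → ((a ⊕ b) ⊕ c) ⊜ ((a ⊕ c) ⊕ b)) refl a b c 1
    ... | yes (a , b , a∈R , b∈B , e) with fuel
    ...   | zero   = contradiction (subst (_ ∈_) (sym (∣p∣≡n⇒p≡⊤ (≤-antisym (∣p∣≤n R) h))) ∈⊤) ∉R
    ...   | suc f  = grow f (R ∪ ⟨ b ⟩) h′ (a , x∈p∪q⁺ (inj₁ a∈R)) d′ r′
      where
      b∉ = ∈-outside⁻ R S b∈B
      h′ : n ≤ f + ∣ R ∪ ⟨ b ⟩ ∣
      h′ = ≤-trans h (≤-reflexive (trans (sym (+-suc f ∣ R ∣)) (cong (f +_) (sym (trans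
             (∪-size-disjoint R ⟨ b ⟩ λ w i j → proj₁ b∉ (subst (_∈ R) (x∈⁅y⁆⇒x≡y b j) i))
             (trans (cong (∣ R ∣ +_) (∣⁅x⁆∣≡1 b)) (+-comm ∣ R ∣ 1)))))))
      d′ : Disjoint (R ∪ ⟨ b ⟩) S
      d′ w i with x∈p∪q⁻ R ⟨ b ⟩ i
      ... | inj₁ j = d w j
      ... | inj₂ j = subst (_∉ S) (sym (x∈⁅y⁆⇒x≡y b j)) (proj₂ b∉)
      r′ : ∀ w → w ∈ R ∪ ⟨ b ⟩ → (w∉S : w ∉ S) → Star (Adj (G -ᵛ S)) u (w , w∉S)
      r′ w i w∉S with x∈p∪q⁻ R ⟨ b ⟩ i
      ... | inj₁ j = r w j w∉S
      ... | inj₂ j with x∈⁅y⁆⇒x≡y b j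
      ... | refl = r a a∈R (λ k → d a a∈R k) ◅◅ (e ◅ ε)

-- Deleting and restoring a single edge

Same : {V : Set} → (x y u v : V) → Set
Same x y u v = (u ≡ x × v ≡ y) ⊎ (u ≡ y × v ≡ x)

module _ {k : ℕ} {H H′ : Graph (Fin n)} {x y : Fin n}
         (split : ∀ u v → Adj H u v → Adj H′ u v ⊎ Same x y u v) where

  -- A pair separated in `H′` but not in `H` has `x` and `y` on opposite sides, in one order or the
  -- other. With fewer than `k` vertices outside, it would be tight at `xy`.
  delete-edge : Inseparable k H → (∀ A B → ¬ Tight k H x y A B) → Inseparable k H′
  delete-edge I ¬t = record { order = order I ; cut = c }
    where
    c : ∀ A B → Nonempty A → Nonempty B → Disjoint A B → NoEdge H′ A B → ∣ A ∣ + ∣ B ∣ + k ≤ n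
    c A B a b d e with (x ∈? A) ×-dec (y ∈? B) | (y ∈? A) ×-dec (x ∈? B)
    ... | yes (i , j) | _ = ≮⇒≥ λ h → ¬t A B record
            { left = i ; right = j ; disjoint = d ; large = h ; only = o }
      where
      o : ∀ u v → u ∈ A → v ∈ B → Adj H u v → u ≡ x × v ≡ y
      o u v p q h with split u v h
      ... | inj₁ h′ = contradiction h′ (e u v p q)
      ... | inj₂ (inj₁ s) = s
      ... | inj₂ (inj₂ (refl , refl)) = contradiction j (d _ p)
    ... | no _ | yes (i , j) = ≮⇒≥ λ h → ¬t B A (Tight-sym record
            { left = i ; right = j ; disjoint = d ; large = h ; only = o })
      where
      o : ∀ u v → u ∈ A → v ∈ B → Adj H u v → u ≡ y × v ≡ x
      o u v p q h with split u v h
      ... | inj₁ h′ = contradiction h′ (e u v p q)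
      ... | inj₂ (inj₂ s) = s
      ... | inj₂ (inj₁ (refl , refl)) = contradiction j (d _ p)
    ... | no ¬p | no ¬q = cut I A B a b d λ u v i j h → [ e u v i j , (λ
            { (inj₁ (refl , refl)) → ¬p (i , j) ; (inj₂ (refl , refl)) → ¬q (i , j) }) ]′ (split u v h)

  -- Carries a tight pair over to the graph in which a matching edge is restored; that edge does no
  -- harm as long as it does not run between the two sides.
  add-edge : ∀ {a b A B} → ¬ (x ∈ A × y ∈ B) → ¬ (y ∈ A × x ∈ B) → Tight k H′ a b A B → Tight k H a b A B
  add-edge ¬p ¬q t = record { left = left t ; right = right t ; disjoint = disjoint t ; large = large t
    ; only = λ u v i j h → [ only t u v i j , (λ
        { (inj₁ (refl , refl)) → contradiction (i , j) ¬p ; (inj₂ (refl , refl)) → contradiction (i , j) ¬q }) ]′ (split u v h) }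

-- Uncrossing tight pairs at consecutive edges

module _ {k : ℕ} {H : Graph (Fin n)} (I : Inseparable k H) where

  -- Removing `y` from `B` leaves no edge to `A`, which gives the bound unless `B` is `y` alone. In
  -- that case at most two of the more than `k` neighbours of `y` lie in `A`, so at least `k - 1`
  -- vertices lie outside `A ∪ B`.
  star-cut : ∀ {x y z} A B → y ∈ B → Nonempty A → Disjoint B A →
             (∀ u v → u ∈ B → v ∈ A → Adj H u v → u ≡ y × (v ≡ x ⊎ v ≡ z)) →
             k < ∣ nbhd H y ∣ → ∣ B ∣ + ∣ A ∣ + k ≤ suc n
  star-cut {x} {y} {z} A B y∈B ne d only kd with nonempty? (B - y)
  ... | yes ne′ = ≤-trans (+-monoˡ-≤ k (+-monoˡ-≤ ∣ A ∣ (delete-size B)))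
        (s≤s (cut I (B - y) A ne′ ne (λ v i → d v (proj₁ (∈-delete⁻ B i)))
              λ u v i j e → let u∈B , u≢y = ∈-delete⁻ B i in u≢y (proj₁ (only u v u∈B j e))))
  ... | no ¬ne = arith (∣ A ∣) (∣ B ∣) (∣ nbhd H y ∣) (∣ ∁ (A ∪ ⟨ y ⟩) ∣)
        (≤-trans (delete-size B) (≤-reflexive (cong suc (Empty-size λ v i → ¬ne (v , i))))) kd
        (≤-trans (p⊆q⇒∣p∣≤∣q∣ N⊆) (≤-trans (∪-size-≤ (⟨ x ⟩ ∪ ⟨ z ⟩) _) (+-monoˡ-≤ _ (pair-size x z))))
        (trans (cong (λ s → ∣ A ∣ + s + ∣ ∁ (A ∪ ⟨ y ⟩) ∣) (sym (∣⁅x⁆∣≡1 y)))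
               (partition-size A ⟨ y ⟩ λ v i j → d y y∈B (subst (_∈ A) (x∈⁅y⁆⇒x≡y y j) i)))
    where
    N⊆ : nbhd H y ⊆ (⟨ x ⟩ ∪ ⟨ z ⟩) ∪ ∁ (A ∪ ⟨ y ⟩)
    N⊆ {v} i with v ∈? A
    ... | yes v∈A = x∈p∪q⁺ (inj₁ (x∈p∪q⁺ ([ (λ { refl → inj₁ (x∈⁅x⁆ x) }) , (λ { refl → inj₂ (x∈⁅x⁆ z) }) ]′
                      (proj₂ (only y v y∈B v∈A (∈-nbhd⁻ H i))))))
    ... | no v∉A  = x∈p∪q⁺ {p = ⟨ x ⟩ ∪ ⟨ z ⟩} (inj₂ (∈-outside⁺ A ⟨ y ⟩ v∉A λ j →
                      irrefl H (subst (Adj H y) (x∈⁅y⁆⇒x≡y y j) (∈-nbhd⁻ H i))))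
    arith : ∀ a b d s → b ≤ 1 → k < d → d ≤ 2 + s → a + 1 + s ≡ n → b + a + k ≤ suc n
    arith a b d s b≤1 k<d d≤ refl = ≤-from (+-mono-≤ b≤1 (≤-trans k<d d≤)) (eq a b k s)
      where
      eq : ∀ a b k s → b + a + k + (1 + (2 + s)) ≡ suc (a + 1 + s) + (b + suc k)
      -- The extra variable `o` stands for `1`, here and in the identities below.
      eq a b k s = linear 5 (λ a b k s o → (((b ⊕ a) ⊕ k) ⊕ (o ⊕ (o ⊕ (o ⊕ s)))) ⊜ ((o ⊕ ((a ⊕ o) ⊕ s)) ⊕ (b ⊕ (o ⊕ k)))) refl a b k s 1

  module _ {x y z A B C D} (t : Tight k H x y A B) (t′ : Tight k H y z C D) (x≢z : x ≢ z)
           (xy : Adj H x y) (yz : Adj H y z) (kd : k < ∣ nbhd H y ∣) where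
    private
      y∈ : y ∈ B ∩ C
      y∈ = x∈p∩q⁺ (right t , left t′)

      x∉D : x ∉ D
      x∉D i = x≢z (proj₂ (only t′ y x (left t′) i (symm H xy)))

      z∉A : z ∉ A
      z∉A i = x≢z (sym (proj₁ (only t z y i (right t) (symm H yz))))

      corner : ∣ B ∩ C ∣ + ∣ A ∪ D ∣ + k ≤ suc n
      corner = star-cut {x} {y} {z} (A ∪ D) (B ∩ C) y∈ (x , x∈p∪q⁺ (inj₁ (left t)))
        (λ v i j → let b , c = x∈p∩q⁻ B C i in [ (λ a → disjoint t v a b) , (λ d → disjoint t′ v c d) ]′ (x∈p∪q⁻ A D j))
        (λ u v i j e → let b , c = x∈p∩q⁻ B C i in
          [ (λ a → let p , q = only t v u a b (symm H e) in q , inj₁ p)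
          , (λ d → let p , q = only t′ u v c d e in p , inj₂ q) ]′ (x∈p∪q⁻ A D j)) kd

    -- A common vertex would make `A ∩ D` and `B ∪ C` a cut, since `x ∉ D` and `z ∉ A`. By
    -- submodularity the two corners add up to at least `2n + 2`, as the two tight pairs do; if this
    -- one has at most `n`, the other exceeds the bound `n + 1` of `corner`.
    far-sides-disjoint : Disjoint A D
    far-sides-disjoint w w∈A w∈D = <⇒≱ (arith (∣ A ∣) (∣ B ∣) (∣ C ∣) (∣ D ∣) (∣ B ∩ C ∣) (∣ B ∪ C ∣) (∣ A ∩ D ∣) (∣ A ∪ D ∣)
        (∪-∩-size B C) (∪-∩-size A D) (large t) (large t′) opposite) corner
      where
      opposite : ∣ B ∪ C ∣ + ∣ A ∩ D ∣ + k ≤ n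
      opposite = cut I (B ∪ C) (A ∩ D) (y , x∈p∪q⁺ (inj₁ (right t))) (w , x∈p∩q⁺ (w∈A , w∈D))
        (λ v i j → let a , d = x∈p∩q⁻ A D j in [ disjoint t v a , (λ c → disjoint t′ v c d) ]′ (x∈p∪q⁻ B C i))
        (λ u v i j e → let a , d = x∈p∩q⁻ A D j in
          [ (λ b → x∉D (subst (_∈ D) (proj₁ (only t v u a b (symm H e))) d))
          , (λ c → z∉A (subst (_∈ A) (proj₂ (only t′ u v c d e)) a)) ]′ (x∈p∪q⁻ B C i))
      arith : ∀ a b c d bc b∪c ad a∪d → b∪c + bc ≡ b + c → a∪d + ad ≡ a + d → suc n ≤ a + b + k →
              suc n ≤ c + d + k → b∪c + ad + k ≤ n → suc n < bc + a∪d + k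
      arith a b c d bc b∪c ad a∪d e₁ e₂ h₁ h₂ h₃ = ≤-from (+-mono-≤ (+-mono-≤ h₁ h₂) h₃)
        (trans (eq₁ n (a + b + k) (c + d + k)) (trans (cong (2 + n + n +_) eq₂) (eq₃ n (bc + a∪d + k) (b∪c + ad + k))))
        where
        eq₁ : ∀ n p q → suc (suc n) + (p + q + n) ≡ 2 + n + n + (p + q)
        eq₁ n p q = linear 4 (λ n p q o → ((o ⊕ (o ⊕ n)) ⊕ ((p ⊕ q) ⊕ n)) ⊜ (((o ⊕ (o ⊕ n)) ⊕ n) ⊕ (p ⊕ q))) refl n p q 1
        eq₂ : (a + b + k) + (c + d + k) ≡ (bc + a∪d + k) + (b∪c + ad + k)
        eq₂ = trans (r₁ a b c d k) (trans (cong₂ (λ p q → p + q + 2 * k) (sym e₂) (sym e₁)) (r₂ bc b∪c ad a∪d k))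
          where
          r₁ : ∀ a b c d k → (a + b + k) + (c + d + k) ≡ (a + d) + (b + c) + 2 * k
          r₁ a b c d k = linear 6 (λ a b c d k o → (((a ⊕ b) ⊕ k) ⊕ ((c ⊕ d) ⊕ k)) ⊜ (((a ⊕ d) ⊕ (b ⊕ c)) ⊕ (k ⊕ (k ⊕ unit)))) refl a b c d k 1
          r₂ : ∀ p q r s k → (s + r) + (q + p) + 2 * k ≡ (p + s + k) + (q + r + k)
          r₂ p q r s k = linear 6 (λ p q r s k o → (((s ⊕ r) ⊕ (q ⊕ p)) ⊕ (k ⊕ (k ⊕ unit))) ⊜ (((p ⊕ s) ⊕ k) ⊕ ((q ⊕ r) ⊕ k))) refl p q r s k 1
        eq₃ : ∀ n p q → 2 + n + n + (p + q) ≡ p + (suc n + suc n + q)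
        eq₃ n p q = linear 4 (λ n p q o → (((o ⊕ (o ⊕ n)) ⊕ n) ⊕ (p ⊕ q)) ⊜ (p ⊕ (((o ⊕ n) ⊕ (o ⊕ n)) ⊕ q))) refl n p q 1

    -- Along a walk of non-removable edges through vertices of degree above k,
    -- the sides ahead shrink: this is Mader's theorem that such a walk cannot close up.
    side-shrinks : ∣ D ∣ < ∣ B ∣
    side-shrinks = ≤-from (+-mono-≤ (+-mono-≤ (∈-size y∈) (large t)) (subst (λ s → ∣ B ∩ C ∣ + s + k ≤ suc n)
        (∪-size-disjoint A D far-sides-disjoint) corner)) (eq (∣ A ∣) (∣ B ∣) (∣ D ∣) (∣ B ∩ C ∣) k n)
      where
      eq : ∀ a b d bc k n → suc d + (bc + (a + b + k) + suc n) ≡ b + (1 + suc n + (bc + (a + d) + k))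
      eq a b d bc k n = linear 7 (λ a b d bc k n o → ((o ⊕ d) ⊕ ((bc ⊕ ((a ⊕ b) ⊕ k)) ⊕ (o ⊕ n))) ⊜ (b ⊕ ((o ⊕ (o ⊕ n)) ⊕ ((bc ⊕ (a ⊕ d)) ⊕ k)))) refl a b d bc k n 1

-- Degrees inside one side of a tight pair

module _ {k : ℕ} {H : Graph (Fin n)} {x y A B} (t : Tight k H x y A B) where

  outside-small : suc ∣ ∁ (A ∪ B) ∣ ≤ k
  outside-small = +-cancelˡ-≤ (∣ A ∣ + ∣ B ∣) _ _ (≤-trans (≤-reflexive
    (trans (+-suc _ _) (cong suc (partition-size A B (disjoint t))))) (large t))

  module _ {a : Fin n} (a∈A : a ∈ A) (kd : k < ∣ nbhd H a ∣) where

    private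
      N = nbhd H a

      located : ∀ {v} → v ∈ N → v ∉ B → v ∈ (N ∩ A) ∪ ∁ (A ∪ B)
      located {v} i v∉B with v ∈? A
      ... | yes j = x∈p∪q⁺ (inj₁ (x∈p∩q⁺ (i , j)))
      ... | no ¬j = x∈p∪q⁺ {p = N ∩ A} (inj₂ (∈-outside⁺ A B ¬j v∉B))

      not-across : a ≢ x → ∀ {v} → v ∈ N → v ∉ B
      not-across a≢x i j = a≢x (proj₁ (only t a _ a∈A j (∈-nbhd⁻ H i)))

    -- In `A` only `x` has a neighbour in `B`. At most `k - 1` of the at least `k + 1` neighbours of
    -- `a` lie in the separator, and the others must be in `A`.
    inner-degree : a ≢ x → 2 ≤ ∣ N ∩ A ∣
    inner-degree a≢x = ≤-from (+-mono-≤ (≤-trans kd (≤-trans (p⊆q⇒∣p∣≤∣q∣ λ i → located i (not-across a≢x i)) (∪-size-≤ (N ∩ A) _)))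
        outside-small) (eq k (∣ ∁ (A ∪ B) ∣) (∣ N ∩ A ∣))
      where
      eq : ∀ k s m → 2 + (m + s + k) ≡ m + (suc k + suc s)
      eq k s m = linear 4 (λ k s m o → (o ⊕ (o ⊕ ((m ⊕ s) ⊕ k))) ⊜ (m ⊕ ((o ⊕ k) ⊕ (o ⊕ s)))) refl k s m 1

    -- Here `a` may be `x` and so lose one more neighbour, namely `y`.
    end-inner-degree : 1 ≤ ∣ N ∩ A ∣
    end-inner-degree = ≤-from (+-mono-≤ (≤-trans kd (≤-trans (p⊆q⇒∣p∣≤∣q∣ sub)
        (≤-trans (∪-size-≤ ⟨ y ⟩ _) (+-mono-≤ (≤-reflexive (∣⁅x⁆∣≡1 y)) (∪-size-≤ (N ∩ A) _)))))
        outside-small) (eq k (∣ ∁ (A ∪ B) ∣) (∣ N ∩ A ∣))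
      where
      sub : N ⊆ ⟨ y ⟩ ∪ ((N ∩ A) ∪ ∁ (A ∪ B))
      sub {v} i with v ∈? B
      ... | yes j = x∈p∪q⁺ (inj₁ (subst (_∈ ⟨ y ⟩) (sym (proj₂ (only t a v a∈A j (∈-nbhd⁻ H i)))) (x∈⁅x⁆ y)))
      ... | no ¬j = x∈p∪q⁺ {p = ⟨ y ⟩} (inj₂ (located i ¬j))
      eq : ∀ k s m → 1 + (1 + (m + s) + k) ≡ m + (suc k + suc s)
      eq k s m = linear 4 (λ k s m o → (o ⊕ ((o ⊕ (m ⊕ s)) ⊕ k)) ⊜ (m ⊕ ((o ⊕ k) ⊕ (o ⊕ s)))) refl k s m 1

    -- This is the equality case of `inner-degree`: with two neighbours in `A`, the degree exceeds
    -- `k` only if the whole separator is seen.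
    sees-outside : a ≢ x → ∣ N ∩ A ∣ ≤ 2 → ∀ {s} → s ∈ ∁ (A ∪ B) → Adj H a s
    sees-outside a≢x low {s} i with adj? H a s
    ... | yes e = e
    ... | no ¬e = contradiction (≤-trans (≤-trans (p⊆q⇒∣p∣≤∣q∣ sub) (∪-size-≤ (N ∩ A) (∁ (A ∪ B) - s)))
                     (≤-from (+-mono-≤ low (≤-trans (s≤s (x∈p⇒∣p-x∣<∣p∣ i)) outside-small)) (eq k (∣ ∁ (A ∪ B) - s ∣) (∣ N ∩ A ∣))))
                     (<⇒≱ kd)
      where
      sub : N ⊆ (N ∩ A) ∪ (∁ (A ∪ B) - s)
      sub {v} j with x∈p∪q⁻ (N ∩ A) _ (located j (not-across a≢x j))
      ... | inj₁ p = x∈p∪q⁺ (inj₁ p)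
      ... | inj₂ p = x∈p∪q⁺ {p = N ∩ A} (inj₂ (x∈p∧x≢y⇒x∈p-y p λ { refl → ¬e (∈-nbhd⁻ H j) }))
      eq : ∀ k s m → m + s + (2 + k) ≡ k + (m + suc (suc s))
      eq k s m = linear 4 (λ k s m o → ((m ⊕ s) ⊕ (o ⊕ (o ⊕ k))) ⊜ (k ⊕ (m ⊕ (o ⊕ (o ⊕ s))))) refl k s m 1

-- Matchings and the vertices they cover

covered : Edges n → Subset n
covered []            = ∅ˢ
covered ((x , y) ∷ M) = (⟨ x ⟩ ∪ ⟨ y ⟩) ∪ covered M

covered-size : (M : Edges n) → ∣ covered M ∣ ≤ size M + size M
covered-size {n} [] = ≤-reflexive (∣⊥∣≡0 n)
covered-size ((x , y) ∷ M) = ≤-trans (∪-size-≤ (⟨ x ⟩ ∪ ⟨ y ⟩) (covered M))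
  (≤-trans (+-mono-≤ (pair-size x y) (covered-size M)) (≤-reflexive (cong suc (sym (+-suc (size M) (size M))))))

module _ {x y : Fin n} {M : Edges n} where

  ∉-covered⁻ : ∀ {v} → v ∉ covered ((x , y) ∷ M) → v ≢ x × v ≢ y × v ∉ covered M
  ∉-covered⁻ ∉ = (λ { refl → ∉ (x∈p∪q⁺ (inj₁ (x∈p∪q⁺ (inj₁ (x∈⁅x⁆ x))))) })
               , (λ { refl → ∉ (x∈p∪q⁺ (inj₁ (x∈p∪q⁺ {p = ⟨ x ⟩} (inj₂ (x∈⁅x⁆ y))))) })
               , (λ i → ∉ (x∈p∪q⁺ {p = ⟨ x ⟩ ∪ ⟨ y ⟩} (inj₂ i)))

  ∈-covered⁻ : ∀ {v} → v ∈ covered ((x , y) ∷ M) → v ≡ x ⊎ v ≡ y ⊎ v ∈ covered M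
  ∈-covered⁻ i with x∈p∪q⁻ (⟨ x ⟩ ∪ ⟨ y ⟩) (covered M) i
  ... | inj₂ j = inj₂ (inj₂ j)
  ... | inj₁ j with x∈p∪q⁻ ⟨ x ⟩ ⟨ y ⟩ j
  ...   | inj₁ h = inj₁ (x∈⁅y⁆⇒x≡y x h)
  ...   | inj₂ h = inj₂ (inj₁ (x∈⁅y⁆⇒x≡y y h))

  ∉-covered⁺ : ∀ {v} → v ≢ x → v ≢ y → v ∉ covered M → v ∉ covered ((x , y) ∷ M)
  ∉-covered⁺ a b c i = [ a , [ b , c ]′ ]′ (∈-covered⁻ i)

  left-covered : x ∈ covered ((x , y) ∷ M)
  left-covered = x∈p∪q⁺ (inj₁ (x∈p∪q⁺ (inj₁ (x∈⁅x⁆ x))))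

  right-covered : y ∈ covered ((x , y) ∷ M)
  right-covered = x∈p∪q⁺ (inj₁ (x∈p∪q⁺ {p = ⟨ x ⟩} (inj₂ (x∈⁅x⁆ y))))

  tail-covered : covered M ⊆ covered ((x , y) ∷ M)
  tail-covered i = x∈p∪q⁺ {p = ⟨ x ⟩ ∪ ⟨ y ⟩} (inj₂ i)

∈ᴱ-covered : ∀ {u v} (M : Edges n) → u — v ∈ᴱ M → u ∈ covered M
∈ᴱ-covered (_ ∷ M) (inj₁ (here refl)) = left-covered {M = M}
∈ᴱ-covered (_ ∷ M) (inj₂ (here refl)) = right-covered {M = M}
∈ᴱ-covered (_ ∷ M) (inj₁ (there i)) = tail-covered {M = M} (∈ᴱ-covered M (inj₁ i))
∈ᴱ-covered (_ ∷ M) (inj₂ (there i)) = tail-covered {M = M} (∈ᴱ-covered M (inj₂ i))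

-- A recursive form that implies `IsMatching`; it is decided edge by edge and speaks of `covered`,
-- as the counting arguments do.
Matching : Graph (Fin n) → Edges n → Set
Matching G []            = ⊤
Matching G ((x , y) ∷ M) = Adj G x y × x ∉ covered M × y ∉ covered M × Matching G M

matching? : (G : Graph (Fin n)) (M : Edges n) → Dec (Matching G M)
matching? G []            = yes tt
matching? G ((x , y) ∷ M) = adj? G x y ×-dec ¬? (x ∈? covered M) ×-dec ¬? (y ∈? covered M) ×-dec matching? G M

Matching⇒IsMatching : {G : Graph (Fin n)} (M : Edges n) → Matching G M → IsMatching G M
Matching⇒IsMatching [] _ = [] , []
Matching⇒IsMatching ((x , y) ∷ M) (e , x∉ , y∉ , m) = let a , b = Matching⇒IsMatching M m in
    e ∷ a , apart M x∉ y∉ ∷ b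
  where
  apart : ∀ M → x ∉ covered M → y ∉ covered M → All (VertexDisjoint (x , y)) M
  apart [] _ _ = []
  apart (_ ∷ M) p q = let a , b , c = ∉-covered⁻ {M = M} p
                          d , e , f = ∉-covered⁻ {M = M} q in (a , b , d , e) ∷ apart M c f

exists-of-size? : {P : Edges n → Set} → Decidable P → ∀ s → Dec (∃ λ M → P M × size M ≡ s)
exists-of-size? P? zero = Dec.map′ (λ p → [] , p , refl) (λ { ([] , p , _) → p ; (_ ∷ _ , _ , ()) }) (P? [])
exists-of-size? P? (suc s) = Dec.map′ (λ (x , y , M , p , e) → (x , y) ∷ M , p , cong suc e)
  (λ { ([] , _ , ()) ; ((x , y) ∷ M , p , e) → x , y , M , p , suc-injective e })
  (any? λ x → any? λ y → exists-of-size? (λ M → P? ((x , y) ∷ M)) s)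

adjacent-≢ : (H : Graph (Fin n)) → ∀ {u v} → Adj H u v → v ≢ u
adjacent-≢ H e refl = irrefl H e

module _ (G : Graph (Fin n)) where

  -- Both ends of an edge of `M` are covered, so an uncovered vertex keeps all its edges.
  keep-edge : ∀ {u v} (M : Edges n) → u ∉ covered M → Adj G u v → Adj (G -ᵉ M) u v
  keep-edge M u∉ e = e , λ i → u∉ (∈ᴱ-covered M i)

  keep-degree : ∀ {v} (M : Edges n) → v ∉ covered M → ∣ nbhd G v ∣ ≤ ∣ nbhd (G -ᵉ M) v ∣
  keep-degree M v∉ = p⊆q⇒∣p∣≤∣q∣ λ i → ∈-nbhd⁺ (G -ᵉ M) (keep-edge M v∉ (∈-nbhd⁻ G i))

  -- Supplies the hypothesis `split` of `delete-edge` and `add-edge`.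
  remove-edge : ∀ x y (M : Edges n) u v → Adj (G -ᵉ M) u v → Adj (G -ᵉ ((x , y) ∷ M)) u v ⊎ Same x y u v
  remove-edge x y M u v (e , ¬i) with (u ≟ x) ×-dec (v ≟ y) | (u ≟ y) ×-dec (v ≟ x)
  ... | yes s | _ = inj₂ (inj₁ s)
  ... | no _ | yes s = inj₂ (inj₂ s)
  ... | no ¬s | no ¬s′ = inj₁ (e , λ
          { (inj₁ (here refl)) → ¬s (refl , refl)
          ; (inj₂ (here refl)) → ¬s′ (refl , refl)
          ; (inj₁ (there i)) → ¬i (inj₁ i)
          ; (inj₂ (there i)) → ¬i (inj₂ i) })

  restore-edge : ∀ x y (M : Edges n) u v → Adj (G -ᵉ ((x , y) ∷ M)) u v → Adj (G -ᵉ M) u v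
  restore-edge x y M u v (e , ¬i) = e , λ { (inj₁ i) → ¬i (inj₁ (there i)) ; (inj₂ i) → ¬i (inj₂ (there i)) }

Inseparable-mono : ∀ {k} {H H′ : Graph (Fin n)} → (∀ u v → Adj H u v → Adj H′ u v) → Inseparable k H → Inseparable k H′
Inseparable-mono f I = record { order = order I
  ; cut = λ A B a b d e → cut I A B a b d λ u v i j h → e u v i j (f u v h) }

another : {p : Subset n} → 2 ≤ ∣ p ∣ → ∀ x → ∃ λ z → z ∈ p × z ≢ x
another {p = p} h x = let z , i = size-nonempty {p = p - x} (s≤s⁻¹ (≤-trans h (delete-size p))) in z , ∈-delete⁻ p i

-- By `delete-edge`, a loose edge can be deleted from a `k`-connected graph without harm.
Loose : (k : ℕ) → Graph (Fin n) → Fin n → Fin n → Set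
Loose k H x y = ∀ A B → ¬ Tight k H x y A B

Loose-sym : ∀ {k} {H : Graph (Fin n)} {x y} → Loose k H x y → Loose k H y x
Loose-sym l A B t = l B A (Tight-sym t)

∩-size-mono : (p q : Subset n) {r s : Subset n} → (∀ {v} → v ∈ p → v ∈ q → v ∈ r × v ∈ s) → ∣ p ∩ q ∣ ≤ ∣ r ∩ s ∣
∩-size-mono p q f = p⊆q⇒∣p∣≤∣q∣ λ i → let a , b = x∈p∩q⁻ p q i in x∈p∩q⁺ (f a b)

Removable : (k : ℕ) → Graph (Fin n) → Edges n → Set
Removable k G M = Matching G M × Inseparable k (G -ᵉ M)

-- Removable matchings that cannot be enlarged

module Maximum {n k p : ℕ} (G : Graph (Fin n))
  (above : ∀ v → k < ∣ nbhd G v ∣) (wide : ∀ v → p + p ≤ ∣ nbhd G v ∣)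
  (none : ¬ ∃ λ M → Removable k G M × size M ≡ suc p) where

  -- For `v ∈ X`: a leaf or an isolated vertex of the graph induced on `X`.
  Low : Subset n → Fin n → Set
  Low X v = ∣ nbhd G v ∩ X ∣ ≤ 1

  low? : ∀ X v → Dec (Low X v)
  low? X v = ∣ nbhd G v ∩ X ∣ ≤? 1

  Max : Edges n → Set
  Max M = Removable k G M × size M ≡ p

  module _ {M : Edges n} (R : Max M) where
    private
      H = G -ᵉ M
      I = proj₂ (proj₁ R)

    -- A loose edge between uncovered vertices could be added to `M`, contrary to `none`.
    loose-covered : ∀ {a b} → a ∉ covered M → b ∉ covered M → Adj G a b → ¬ Loose k H a b
    loose-covered {a} {b} a∉ b∉ e l = none ((a , b) ∷ M ,
      ((e , a∉ , b∉ , proj₁ (proj₁ R)) , delete-edge (remove-edge G a b M) I l) , cong suc (proj₂ R))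

    inner-tight : ∀ {a b} → a ∉ covered M → b ∉ covered M → Adj G a b → ∃₂ λ A B → Tight k H a b A B
    inner-tight {a} {b} a∉ b∉ e with tight? k H a b
    ... | yes t = t
    ... | no ¬t = contradiction (λ A B t → ¬t (A , B , t)) (loose-covered a∉ b∉ e)

    above-H : ∀ {v} → v ∉ covered M → k < ∣ nbhd H v ∣
    above-H v∉ = ≤-trans (above _) (keep-degree G M v∉)

    -- Otherwise a walk in `X` could go on forever without turning back. Its edges are all tight, as
    -- `M` cannot be enlarged, and by `side-shrinks` the side ahead gets smaller at each step.
    low-vertex : ∀ X → Nonempty X → Disjoint X (covered M) → ∃ λ v → v ∈ X × Low X v
    low-vertex X (x , x∈X) d with any? (λ v → (v ∈? X) ×-dec low? X v)
    ... | yes r = r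
    ... | no ¬low = let y , i , _ = another (high x∈X) x
                        y∈N , y∈X = x∈p∩q⁻ (nbhd G x) X i
                        e = ∈-nbhd⁻ G y∈N
                        A , B , t = inner-tight (d x x∈X) (d y y∈X) e
                    in ⊥-elim (descend _ x∈X y∈X e t ≤-refl)
      where
      high : ∀ {v} → v ∈ X → 2 ≤ ∣ nbhd G v ∩ X ∣
      high i = ≰⇒> λ l → ¬low (_ , i , l)
      descend : ∀ s {x y A B} → x ∈ X → y ∈ X → Adj G x y → Tight k H x y A B → ∣ B ∣ ≤ s → ⊥
      descend s {x} {y} {A} {B} x∈X y∈X e t h with another (high y∈X) x
      ... | z , i , z≢x with x∈p∩q⁻ (nbhd G y) X i
      ... | z∈N , z∈X with inner-tight (d y y∈X) (d z z∈X) (∈-nbhd⁻ G z∈N)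
      ... | C , D , t′ with side-shrinks I t t′ (z≢x ∘ sym) (keep-edge G M (d x x∈X) e)
                              (keep-edge G M (d y y∈X) (∈-nbhd⁻ G z∈N)) (above-H (d y y∈X))
      descend zero _ _ _ _ h | _ , _ , _ | _ | _ | D<B = contradiction (≤-trans D<B h) λ ()
      descend (suc s) _ y∈X _ _ h | z , _ | z∈N , z∈X | C , D , t′ | D<B =
        descend s y∈X z∈X (∈-nbhd⁻ G z∈N) t′ (s≤s⁻¹ (≤-trans D<B h))

    -- This is the second leaf of a forest: should the low vertex found be `q` itself, it is removed
    -- and the search goes on in `X - q`.
    low-vertex-other : ∀ X q → Disjoint X (covered M) → (∃ λ w → w ∈ X × w ≢ q) → ∃ λ v → v ∈ X × v ≢ q × Low X v
    low-vertex-other X q d ne = go ∣ X ∣ X q ≤-refl d ne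
      where
      go : ∀ s X q → ∣ X ∣ ≤ s → Disjoint X (covered M) → (∃ λ w → w ∈ X × w ≢ q) → ∃ λ v → v ∈ X × v ≢ q × Low X v
      go s X q h d (w , w∈X , w≢q) with low-vertex X (w , w∈X) d
      ... | a , a∈X , la with a ≟ q
      ... | no a≢q = a , a∈X , a≢q , la
      ... | yes refl with any? (λ b → (b ∈? X) ×-dec adj? G q b)
      -- `q` is isolated in `X`, so its removal changes no other degree.
      ...   | no ¬b = let v , i , l = low-vertex (X - q) (w , x∈p∧x≢y⇒x∈p-y w∈X w≢q) (λ v i → d v (proj₁ (∈-delete⁻ X i)))
                          v∈X , v≢q = ∈-delete⁻ X i
                      in v , v∈X , v≢q , ≤-trans (∩-size-mono (nbhd G v) X {s = X - q} λ {u} a b → a ,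
                           x∈p∧x≢y⇒x∈p-y b λ { refl → ¬b (v , v∈X , symm G (∈-nbhd⁻ G a)) }) l
      ...   | yes (b , b∈X , e) with any? (λ c → (c ∈? (X - q)) ×-dec ¬? (c ≟ b))
      -- Only `q` and `b` are left in `X`.
      ...     | no ¬c = b , b∈X , (λ { refl → irrefl G e }) , ≤-trans (p⊆q⇒∣p∣≤∣q∣ sub) (≤-reflexive (∣⁅x⁆∣≡1 q))
        where
        sub : nbhd G b ∩ X ⊆ ⟨ q ⟩
        sub {v} i with x∈p∩q⁻ (nbhd G b) X i | v ≟ q
        ... | _ , _ | yes refl = x∈⁅x⁆ q
        ... | v∈N , v∈X | no v≢q = ⊥-elim (¬c (v , x∈p∧x≢y⇒x∈p-y v∈X v≢q , λ { refl → irrefl G (∈-nbhd⁻ G v∈N) }))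
      go zero X q h d _ | a , a∈X , la | yes refl | yes (b , b∈X , e) | yes _ = contradiction (≤-trans (∈-size a∈X) h) λ ()
      -- The only neighbour of `q` in `X` is `b`, so a vertex `v ≢ b` that is low in `X - q` is low
      -- in `X` as well.
      go (suc s) X q h d _ | a , a∈X , la | yes refl | yes (b , b∈X , e) | yes (c , c∈ , c≢b) =
        let v , i , v≢b , l = go s (X - q) b (s≤s⁻¹ (≤-trans (x∈p⇒∣p-x∣<∣p∣ a∈X) h)) (λ v i → d v (proj₁ (∈-delete⁻ X i))) (c , c∈ , c≢b)
            v∈X , v≢q = ∈-delete⁻ X i
        in v , v∈X , v≢q , ≤-trans (∩-size-mono (nbhd G v) X {s = X - q} λ {u} i j → i , x∈p∧x≢y⇒x∈p-y j λ { refl →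
             <⇒≱ (≢-pair-size (x∈p∩q⁺ (∈-nbhd⁺ G (symm G (∈-nbhd⁻ G i)) , v∈X)) (x∈p∩q⁺ (∈-nbhd⁺ G e , b∈X)) v≢b) la }) l

    -- The far side of a tight pair at an inner edge uq contains a covered non-neighbour of u;
    -- otherwise that side would span a forest of vertices of degree above k.
    inner-obstacle : ∀ {u q A B} → u ∉ covered M → q ∉ covered M → Tight k H q u A B →
                     ∃ λ w → w ∈ A × w ∈ covered M × ¬ Adj G u w
    inner-obstacle {u} {q} {A} {B} u∉ q∉ t with any? (λ w → (w ∈? A) ×-dec (w ∈? covered M) ×-dec ¬? (adj? G u w))
    ... | yes r = r
    ... | no ¬w = ⊥-elim (<⇒≱ (inner-degree t v∈A (above-H (free v v∈A)) v≢q)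
            (≤-trans (∩-size-mono (nbhd H v) A λ i j → ∈-nbhd⁺ G (proj₁ (∈-nbhd⁻ H i)) , j) low))
      where
      free : Disjoint A (covered M)
      free a a∈A a∈M with adj? G u a
      ... | no ¬e = ¬w (a , a∈A , a∈M , ¬e)
      ... | yes e = q∉ (subst (_∈ covered M) (proj₁ (only t a u a∈A (right t) (symm H (keep-edge G M u∉ e)))) a∈M)
      found = let z , i = size-nonempty (end-inner-degree t (left t) (above-H q∉))
                  z∈N , z∈A = x∈p∩q⁻ (nbhd H q) A i
              in low-vertex-other A q free (z , z∈A , adjacent-≢ H (∈-nbhd⁻ H z∈N))
      v = proj₁ found
      v∈A = proj₁ (proj₂ found)
      v≢q = proj₁ (proj₂ (proj₂ found))
      low = proj₂ (proj₂ (proj₂ found))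

  module _ {M : Edges n} (R : Max M) where

    covered-≤ : ∣ covered M ∣ ≤ p + p
    covered-≤ = subst (λ s → ∣ covered M ∣ ≤ s + s) (proj₂ R) (covered-size M)

    -- Missing `w`, the vertex `u` has at most `2p - 1` covered neighbours, fewer than its degree.
    inner-neighbour : ∀ {u w} → w ∈ covered M → ¬ Adj G u w → ∃ λ q → q ∉ covered M × Adj G u q
    inner-neighbour {u} {w} w∈ ¬e with any? (λ q → ¬? (q ∈? covered M) ×-dec adj? G u q)
    ... | yes r = r
    ... | no ¬q = contradiction (≤-trans (≤-trans (x∈p⇒∣p-x∣<∣p∣ w∈) covered-≤) (wide u)) (≤⇒≯ (p⊆q⇒∣p∣≤∣q∣ sub))
      where
      sub : nbhd G u ⊆ covered M - w
      sub {v} i with v ∈? covered M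
      ... | yes j = x∈p∧x≢y⇒x∈p-y j λ { refl → ¬e (∈-nbhd⁻ G i) }
      ... | no ¬j = contradiction (v , ¬j , ∈-nbhd⁻ G i) ¬q

    -- With at most one uncovered neighbour and at most `2p` covered vertices, missing two of the
    -- latter would leave `u` a degree below `2p`.
    missed-unique : ∀ {u w w′} → Low (∁ (covered M)) u → w ∈ covered M → w′ ∈ covered M →
                    ¬ Adj G u w → ¬ Adj G u w′ → w ≡ w′
    missed-unique {u} {w} {w′} low w∈ w′∈ ¬e ¬e′ with w′ ≟ w
    ... | yes eq = sym eq
    ... | no w′≢w = contradiction
            (≤-trans (x∈p⇒∣p-x∣<∣p∣ (x∈p∧x≢y⇒x∈p-y w′∈ w′≢w)) (s≤s⁻¹ (≤-trans (x∈p⇒∣p-x∣<∣p∣ w∈)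
              (≤-trans covered-≤ (≤-trans (wide u) (≤-trans (p⊆q⇒∣p∣≤∣q∣ sub)
                (≤-trans (∪-size-≤ (nbhd G u ∩ ∁ (covered M)) _) (+-monoˡ-≤ _ low))))))))
            (<-irrefl refl)
      where
      sub : nbhd G u ⊆ (nbhd G u ∩ ∁ (covered M)) ∪ ((covered M - w) - w′)
      sub {v} i with v ∈? covered M
      ... | yes j = x∈p∪q⁺ {p = nbhd G u ∩ ∁ (covered M)} (inj₂ (x∈p∧x≢y⇒x∈p-y
                      (x∈p∧x≢y⇒x∈p-y j λ { refl → ¬e (∈-nbhd⁻ G i) }) λ { refl → ¬e′ (∈-nbhd⁻ G i) }))
      ... | no ¬j = x∈p∪q⁺ (inj₁ (x∈p∩q⁺ (i , x∉p⇒x∈∁p ¬j)))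

  Max-flip : ∀ {x y M} → Max ((x , y) ∷ M) → Max ((y , x) ∷ M)
  Max-flip (((e , x∉ , y∉ , m) , I) , s) = ((symm G e , y∉ , x∉ , m) , Inseparable-mono (λ u v (e , ¬i) → e , λ
    { (inj₁ (here refl)) → ¬i (inj₂ (here refl)) ; (inj₂ (here refl)) → ¬i (inj₁ (here refl))
    ; (inj₁ (there i)) → ¬i (inj₁ (there i)) ; (inj₂ (there i)) → ¬i (inj₂ (there i)) }) I) , s

  -- Restoring an edge of the matching

  module AtEdge {x y : Fin n} {M : Edges n} (R : Max ((x , y) ∷ M)) where
    private
      M⁺ = (x , y) ∷ M
      H  = G -ᵉ M⁺

    G′ : Graph (Fin n)
    G′ = G -ᵉ M

    edge : Adj G x y
    edge = proj₁ (proj₁ (proj₁ R))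

    x∉M : x ∉ covered M
    x∉M = proj₁ (proj₂ (proj₁ (proj₁ R)))

    y∉M : y ∉ covered M
    y∉M = proj₁ (proj₂ (proj₂ (proj₁ (proj₁ R))))

    matching : Matching G M
    matching = proj₂ (proj₂ (proj₂ (proj₁ (proj₁ R))))

    robust : Inseparable k G′
    robust = Inseparable-mono (restore-edge G x y M) (proj₂ (proj₁ R))

    above-G′ : ∀ {v} → v ∉ covered M → k < ∣ nbhd G′ v ∣
    above-G′ v∉ = ≤-trans (above _) (keep-degree G M v∉)

    free : ∀ {v} → v ∉ covered M⁺ → v ∉ covered M
    free v∉ = proj₂ (proj₂ (∉-covered⁻ {M = M} v∉))

    private
      module Unobstructed {u A B} (u∉ : u ∉ covered M⁺) (ux : Adj G u x) (t : Tight k G′ x u A B)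
        (seen : ∀ w → w ∈ A → w ∈ covered M⁺ → Adj G u w) where

        X = A - x

        X⁻ : ∀ {v} → v ∈ X → v ∈ A × v ≢ x
        X⁻ = ∈-delete⁻ A

        -- A covered vertex of `A` is seen by `u ∈ B`, and only `x` has a neighbour across the pair.
        X-free : Disjoint X (covered M⁺)
        X-free a a∈X a∈M = proj₂ (X⁻ a∈X) (proj₁ (only t a u (proj₁ (X⁻ a∈X)) (right t)
          (symm G′ (keep-edge G M (free u∉) (seen a (proj₁ (X⁻ a∈X)) a∈M)))))

        X-nonempty : Nonempty X
        X-nonempty = let z , i = size-nonempty (end-inner-degree t (left t) (above-G′ x∉M))
                         z∈N , z∈A = x∈p∩q⁻ (nbhd G′ x) A i
                     in z , x∈p∧x≢y⇒x∈p-y z∈A (adjacent-≢ G′ (∈-nbhd⁻ G′ z∈N))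

        module LowIn {a : Fin n} (a∈X : a ∈ X) (low : Low X a) where
          private
            a∈A = proj₁ (X⁻ a∈X)
            a≢x = proj₂ (X⁻ a∈X)
            deg-a = above-G′ (free (X-free a a∈X))

            -- Against the lower bound 2 of `inner-degree` this is tight for a low vertex: `a` must
            -- see `x`, one vertex of `X`, and the whole separator.
            bound : ∣ nbhd G′ a ∩ A ∣ ≤ 1 + ∣ nbhd G a ∩ X ∣
            bound = ≤-trans (p⊆q⇒∣p∣≤∣q∣ sub) (≤-trans (∪-size-≤ ⟨ x ⟩ (nbhd G a ∩ X)) (+-monoˡ-≤ _ (≤-reflexive (∣⁅x⁆∣≡1 x))))
              where
              sub : nbhd G′ a ∩ A ⊆ ⟨ x ⟩ ∪ (nbhd G a ∩ X)
              sub {v} i with x∈p∩q⁻ (nbhd G′ a) A i | v ≟ x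
              ... | _ , _ | yes refl = x∈p∪q⁺ (inj₁ (x∈⁅x⁆ x))
              ... | j , l | no v≢x = x∈p∪q⁺ {p = ⟨ x ⟩} (inj₂ (x∈p∩q⁺
                    (∈-nbhd⁺ G (proj₁ (∈-nbhd⁻ G′ j)) , x∈p∧x≢y⇒x∈p-y l v≢x)))

          partner : ∃ λ q → q ∈ X × Adj G a q
          partner = let q , i = size-nonempty (s≤s⁻¹ (≤-trans (inner-degree t a∈A deg-a a≢x) bound))
                        q∈N , q∈X = x∈p∩q⁻ (nbhd G a) X i in q , q∈X , ∈-nbhd⁻ G q∈N

          sees-x : Adj G a x
          sees-x = Dec.decidable-stable (adj? G a x) λ ¬e → <⇒≱ (inner-degree t a∈A deg-a a≢x)
            (≤-trans (∩-size-mono (nbhd G′ a) A {s = X} λ i j → ∈-nbhd⁺ G (proj₁ (∈-nbhd⁻ G′ i)) ,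
               x∈p∧x≢y⇒x∈p-y j λ { refl → ¬e (proj₁ (∈-nbhd⁻ G′ i)) }) low)

          sees-outside′ : ∀ {s} → s ∈ ∁ (A ∪ B) → Adj G a s
          sees-outside′ i = proj₁ (sees-outside t a∈A deg-a a≢x (≤-trans bound (s≤s low)) i)

        module Leaf {a q : Fin n} (a∈X : a ∈ X) (low : Low X a) (q∈X : q ∈ X) (aq : Adj G a q) where
          private module La = LowIn a∈X low

          module Extended {s : Fin n} (s∈S : s ∈ ∁ (A ∪ B)) where
            X⁺ = X ∪ ⟨ s ⟩

            X⊆ : ∀ {v} → v ∈ X → v ∈ X⁺
            X⊆ i = x∈p∪q⁺ (inj₁ i)

            s∈X⁺ : s ∈ X⁺
            s∈X⁺ = x∈p∪q⁺ {p = X} (inj₂ (x∈⁅x⁆ s))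

            old-high : ∀ {b} → b ∈ X → ¬ Low X⁺ b
            old-high {b} b∈X low′ = <⇒≱ (≢-pair-size
                (x∈p∩q⁺ (∈-nbhd⁺ G (proj₂ (proj₂ Lb.partner)) , X⊆ (proj₁ (proj₂ Lb.partner))))
                (x∈p∩q⁺ (∈-nbhd⁺ G (Lb.sees-outside′ s∈S) , s∈X⁺))
                λ e → proj₁ (∈-outside⁻ A B s∈S) (subst (_∈ A) e (proj₁ (X⁻ (proj₁ (proj₂ Lb.partner)))))) low′
              where module Lb = LowIn b∈X (≤-trans (∩-size-mono (nbhd G b) X {s = X⁺} λ i j → i , X⊆ j) low′)

            new-high : ¬ Low X⁺ s
            new-high low′ = let c , c∈X , c≢a , low-c = low-vertex-other R X a X-free (q , q∈X , adjacent-≢ G aq) in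
              <⇒≱ (≢-pair-size
                (x∈p∩q⁺ (∈-nbhd⁺ G (symm G (La.sees-outside′ s∈S)) , X⊆ a∈X))
                (x∈p∩q⁺ (∈-nbhd⁺ G (symm G (LowIn.sees-outside′ c∈X low-c s∈S)) , X⊆ c∈X))
                (c≢a ∘ sym)) low′

            -- If `s` were uncovered, `X⁺` would contain a low vertex. But a vertex of `X` low in
            -- `X⁺` would see both its partner and `s`, while `s` is seen by two low vertices of
            -- `X`.
            s-covered : s ∈ covered M⁺
            s-covered = Dec.decidable-stable (s ∈? covered M⁺) λ s∉ →
              let b , b∈ , low′ = low-vertex R X⁺ (a , X⊆ a∈X) (λ v i → [ X-free v ,
                        (λ j → subst (_∉ covered M⁺) (sym (x∈⁅y⁆⇒x≡y s j)) s∉) ]′ (x∈p∪q⁻ X ⟨ s ⟩ i))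
              in [ (λ i → old-high i low′) , (λ i → new-high (subst (Low X⁺) (x∈⁅y⁆⇒x≡y s i) low′)) ]′ (x∈p∪q⁻ X ⟨ s ⟩ b∈)

          module Pair {P Q} (t′ : Tight k H q a P Q) where

            a-only : ∀ {b} → b ∈ P → Adj G a b → b ≡ q
            a-only {b} b∈P e = proj₁ (only t′ b a b∈P (right t′) (symm H (keep-edge G M⁺ (X-free a a∈X) e)))

            -- A neighbour of `v` is not in `B`, as `v ≢ x`. Nor is it `x` or in the separator: `a`
            -- sees all of these, but its only neighbour in `P` is `q`, which is uncovered and
            -- differs from `x`.
            closed : ∀ {v b} → v ∈ P → v ∈ X → b ∈ P → Adj H v b → b ∈ X
            closed {v} {b} v∈P v∈X b∈P e with b ∈? A | b ∈? B
            ... | yes b∈A | _ = x∈p∧x≢y⇒x∈p-y b∈A λ { refl → proj₂ (X⁻ q∈X) (sym (a-only b∈P La.sees-x)) }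
            ... | no b∉A | yes b∈B = contradiction (proj₁ (only t v b (proj₁ (X⁻ v∈X)) b∈B (restore-edge G x y M v b e))) (proj₂ (X⁻ v∈X))
            ... | no b∉A | no b∉B = contradiction (subst (_∈ covered M⁺) (a-only b∈P (La.sees-outside′ b∈S)) (Extended.s-covered b∈S)) (X-free q q∈X)
              where b∈S = ∈-outside⁺ A B b∉A b∉B

            -- By `closed`, a vertex of `P ∩ X` has all its `H`-neighbours in `P` inside `X`, so a
            -- low vertex of `P ∩ X` other than `q` contradicts `inner-degree`.
            absurd : ⊥
            absurd =
              let z , i = size-nonempty (end-inner-degree t′ (left t′) (above-H R (X-free q q∈X)))
                  z∈N , z∈P = x∈p∩q⁻ (nbhd H q) P i
                  e = ∈-nbhd⁻ H z∈N
                  v , v∈ , v≢q , low-v = low-vertex-other R (P ∩ X) q (λ v i → X-free v (proj₂ (x∈p∩q⁻ P X i)))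
                     (z , x∈p∩q⁺ (z∈P , closed (left t′) q∈X z∈P e) , adjacent-≢ H e)
                  v∈P , v∈X = x∈p∩q⁻ P X v∈
              in <⇒≱ (inner-degree t′ v∈P (above-H R (X-free v v∈X)) v≢q)
                   (≤-trans (∩-size-mono (nbhd H v) P {s = P ∩ X} λ i j → ∈-nbhd⁺ G (proj₁ (∈-nbhd⁻ H i)) ,
                     x∈p∩q⁺ (j , closed v∈P v∈X j (∈-nbhd⁻ H i))) low-v)

        absurd : ⊥
        absurd = let a , a∈X , low = low-vertex R X X-nonempty X-free
                     q , q∈X , aq = LowIn.partner a∈X low
                     P , Q , t′ = inner-tight R (X-free q q∈X) (X-free a a∈X) (symm G aq)
                 in Leaf.Pair.absurd a∈X low q∈X aq t′

    -- If the side A of x contains no such w, then A - x is uncovered, so it spans a forest whose low vertices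
    -- see x and the whole separator; the separator is then covered, and a tight pair at a leaf edge of
    -- that forest cannot contain enough neighbours of the inner end of this edge.
    restored-obstacle : ∀ {u A B} → u ∉ covered M⁺ → Adj G u x → Tight k G′ x u A B →
                        ∃ λ w → w ∈ A × w ∈ covered M⁺ × ¬ Adj G u w
    restored-obstacle {u} {A} {B} u∉ ux t with any? (λ w → (w ∈? A) ×-dec (w ∈? covered M⁺) ×-dec ¬? (adj? G u w))
    ... | yes r = r
    ... | no ¬w = ⊥-elim (Unobstructed.absurd u∉ ux t λ w i j → Dec.decidable-stable (adj? G u w) λ ¬e → ¬w (w , i , j , ¬e))

    -- A tight pair at `xu` and one at an inner edge `uq` would each have, on the side away from
    -- `u`, a covered vertex that `u` misses. A low vertex misses only one, so these sides meet,
    -- against `far-sides-disjoint`. The second pair survives restoring `xy`, because `u` sees `x`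
    -- and `y` and hence neither is in `P`.
    loose-at-low : ∀ {u} → u ∉ covered M⁺ → Low (∁ (covered M⁺)) u → Adj G u x → Adj G u y → Loose k G′ x u
    loose-at-low {u} u∉ low ux uy A B t with restored-obstacle u∉ ux t
    ... | w , w∈A , w∈M , ¬uw with inner-neighbour R w∈M ¬uw
    ... | q , q∉ , uq with inner-tight R q∉ u∉ (symm G uq)
    ... | P , Q , t′ with inner-obstacle R u∉ q∉ t′
    ... | w′ , w′∈P , w′∈M , ¬uw′ with missed-unique R low w∈M w′∈M ¬uw ¬uw′
    ... | refl = far-sides-disjoint robust t (Tight-sym t″) x≢q (symm G′ (keep-edge G M (free u∉) ux))
                   (keep-edge G M (free u∉) uq) (above-G′ (free u∉)) w w∈A w′∈P
      where
      unseen : ∀ {z} → z ∈ covered M⁺ → Adj G u z → z ∉ P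
      unseen z∈M e z∈P = q∉ (subst (_∈ covered M⁺) (proj₁ (only t′ _ u z∈P (right t′) (symm H (keep-edge G M⁺ u∉ e)))) z∈M)
      t″ = add-edge (remove-edge G x y M) (λ (i , _) → unseen (left-covered {M = M}) ux i)
             (λ (i , _) → unseen (right-covered {M = M}) uy i) t′
      x≢q : x ≢ q
      x≢q refl = q∉ (left-covered {M = M})

    -- Removing uy and vx from G′ leaves no tight pair: one separating both would be crossed by ux or by xy.
    augment : ∀ {u v} → u ∉ covered M⁺ → v ∉ covered M⁺ → u ≢ v → Adj G u x → Adj G u y → Adj G v x →
              Loose k G′ u y → ¬ Loose k G′ v x
    augment {u} {v} u∉ v∉ u≢v ux uy vx loose loose′ = none ((v , x) ∷ (u , y) ∷ M , ((vx ,
        ∉-covered⁺ {M = M} (u≢v ∘ sym) (v≢ y (right-covered {M = M})) (free v∉) ,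
        ∉-covered⁺ {M = M} (λ { refl → u∉ (left-covered {M = M}) }) x≢y x∉M , uy , free u∉ , y∉M , matching) ,
        delete-edge (remove-edge G v x ((u , y) ∷ M)) (delete-edge (remove-edge G u y M) robust loose) loose″) ,
        cong suc (proj₂ R))
      where
      x≢y : x ≢ y
      x≢y refl = irrefl G edge
      v≢ : ∀ z → z ∈ covered M⁺ → v ≢ z
      v≢ z z∈ refl = v∉ z∈
      loose″ : Loose k (G -ᵉ ((u , y) ∷ M)) v x
      loose″ A B t = loose′ A B (add-edge (remove-edge G u y M)
        (λ (u∈A , _) → u≢v (proj₁ (only t u x u∈A (right t)
          (ux , λ { (inj₁ (here refl)) → x≢y refl ; (inj₂ (here refl)) → x≢y refl
                  ; (inj₁ (there i)) → free u∉ (∈ᴱ-covered M (inj₁ i)) ; (inj₂ (there i)) → free u∉ (∈ᴱ-covered M (inj₂ i)) }))))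
        (λ (y∈A , _) → v≢ y (right-covered {M = M}) (sym (proj₁ (only t y x y∈A (right t)
          (symm G edge , λ { (inj₁ (here refl)) → x≢y refl ; (inj₂ (here refl)) → u∉ (left-covered {M = M})
                  ; (inj₁ (there i)) → y∉M (∈ᴱ-covered M (inj₁ i)) ; (inj₂ (there i)) → y∉M (∈ᴱ-covered M (inj₂ i)) }))))) t)

  -- Tips and exchanges at one matching edge

  record Tip (M : Edges n) (u : Fin n) : Set where
    constructor tip
    field
      uncovered : u ∉ covered M
      low       : Low (∁ (covered M)) u

  Tip-resp : ∀ {M M′ : Edges n} {u} → covered M ⊆ covered M′ → covered M′ ⊆ covered M → Tip M u → Tip M′ u
  Tip-resp {M} {M′} {u} f g (tip u∉ low) = tip (u∉ ∘ g) (≤-trans (∩-size-mono (nbhd G u) (∁ (covered M′)) {s = ∁ (covered M)}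
    λ i j → i , x∉p⇒x∈∁p λ l → x∈∁p⇒x∉p j (f l)) low)

  covered-flip : ∀ {x y} (M : Edges n) → covered ((x , y) ∷ M) ⊆ covered ((y , x) ∷ M)
  covered-flip {x} {y} M {v} i = [ (λ { refl → right-covered {M = M} })
    , [ (λ { refl → left-covered {M = M} }) , tail-covered {M = M} ]′ ]′ (∈-covered⁻ {M = M} i)

  covered-swap : ∀ {x y x′ y′} (M : Edges n) → covered ((x , y) ∷ (x′ , y′) ∷ M) ⊆ covered ((x′ , y′) ∷ (x , y) ∷ M)
  covered-swap {x} {y} {x′} {y′} M i =
    [ (λ { refl → tail-covered {M = (x , y) ∷ M} (left-covered {M = M}) })
    , [ (λ { refl → tail-covered {M = (x , y) ∷ M} (right-covered {M = M}) })
    , (λ j → [ (λ { refl → left-covered {M = (x , y) ∷ M} })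
             , [ (λ { refl → right-covered {M = (x , y) ∷ M} })
               , (λ l → tail-covered {M = (x , y) ∷ M} (tail-covered {M = M} l)) ]′ ]′ (∈-covered⁻ {M = M} j)) ]′ ]′
    (∈-covered⁻ {M = (x′ , y′) ∷ M} i)

  Tip-flip : ∀ {x y} (M : Edges n) {u} → Tip ((x , y) ∷ M) u → Tip ((y , x) ∷ M) u
  Tip-flip {x} {y} M = Tip-resp {(x , y) ∷ M} {(y , x) ∷ M} (covered-flip M) (covered-flip M)

  Tip-swap : ∀ {x y x′ y′} (M : Edges n) {u} → Tip ((x , y) ∷ (x′ , y′) ∷ M) u → Tip ((x′ , y′) ∷ (x , y) ∷ M) u
  Tip-swap {x} {y} {x′} {y′} M = Tip-resp {(x , y) ∷ (x′ , y′) ∷ M} {(x′ , y′) ∷ (x , y) ∷ M} (covered-swap M) (covered-swap M)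

  Max-swap : ∀ {x y x′ y′ M} → Max ((x , y) ∷ (x′ , y′) ∷ M) → Max ((x′ , y′) ∷ (x , y) ∷ M)
  Max-swap {x} {y} {x′} {y′} {M} (((e , x∉ , y∉ , e′ , x′∉ , y′∉ , m) , I) , s) =
    ((e′ , ∉-covered⁺ {M = M} (proj₁ a ∘ sym) (proj₁ b ∘ sym) x′∉
         , ∉-covered⁺ {M = M} (proj₁ (proj₂ a) ∘ sym) (proj₁ (proj₂ b) ∘ sym) y′∉
         , e , proj₂ (proj₂ a) , proj₂ (proj₂ b) , m) ,
     Inseparable-mono (λ u v (h , ¬i) → h , λ { (inj₁ i) → ¬i (inj₁ (move i)) ; (inj₂ i) → ¬i (inj₂ (move i)) }) I) , s
    where
    a = ∉-covered⁻ {M = M} x∉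
    b = ∉-covered⁻ {M = M} y∉
    move : ∀ {z} → z ∈ᴸ (x′ , y′) ∷ (x , y) ∷ M → z ∈ᴸ (x , y) ∷ (x′ , y′) ∷ M
    move (here e) = there (here e)
    move (there (here e)) = here e
    move (there (there i)) = there (there i)

  module AtTips {x y : Fin n} {M : Edges n} (R : Max ((x , y) ∷ M)) where
    open AtEdge R
    private
      M⁺ : Edges n
      M⁺ = (x , y) ∷ M
      H  = G -ᵉ M⁺

    loose-x : ∀ {u} → Tip M⁺ u → Adj G u x → Adj G u y → Loose k G′ x u
    loose-x (tip u∉ low) ux uy = loose-at-low u∉ low ux uy

    loose-y : ∀ {u} → Tip M⁺ u → Adj G u x → Adj G u y → Loose k G′ y u
    loose-y t ux uy = let tip u∉ low = Tip-flip M t in AtEdge.loose-at-low (Max-flip R) u∉ low uy ux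

    -- Both `uy` and `vx` are loose by `loose-at-low`, so they could replace `xy`.
    two-sided : ∀ {u v} → Tip M⁺ u → Tip M⁺ v → u ≢ v → Adj G u x → Adj G u y → Adj G v x → Adj G v y → ⊥
    two-sided u-tip v-tip u≢v ux uy vx vy = augment (Tip.uncovered u-tip) (Tip.uncovered v-tip) u≢v ux uy vx
      (Loose-sym (loose-y u-tip ux uy)) (Loose-sym (loose-x v-tip vx vy))

    module OneSided {u v : Fin n} (u-tip : Tip M⁺ u) (v-tip : Tip M⁺ v) (u≢v : u ≢ v)
      (ux : Adj G u x) (uy : Adj G u y) (vx : Adj G v x) (¬vy : ¬ Adj G v y)
      (third : ∀ z → Tip M⁺ z → z ≢ u → z ≢ v → ⊥) where

      private
        u∉ = Tip.uncovered u-tip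
        v∉ = Tip.uncovered v-tip

        x≢y : x ≢ y
        x≢y refl = irrefl G edge

        x∈M⁺ : x ∈ covered M⁺
        x∈M⁺ = left-covered {M = M}

        y∈M⁺ : y ∈ covered M⁺
        y∈M⁺ = right-covered {M = M}

        ≢-covered : ∀ {a b} → a ∉ covered M⁺ → b ∈ covered M⁺ → a ≢ b
        ≢-covered a∉ b∈ refl = a∉ b∈

        v-partner : ∃ λ q → q ∉ covered M⁺ × Adj G v q
        v-partner = inner-neighbour R y∈M⁺ ¬vy

        -- Crossing a tight pair at xv with a tight pair at an inner edge vq produces one at xy.
        module Crossed {A B P Q q} (t : Tight k G′ x v A B) (y∈A : y ∈ A) (q∉ : q ∉ covered M⁺) (vq : Adj G v q)
          (t′ : Tight k H q v P Q) (y∈P : y ∈ P) (loose : Loose k G′ x y) where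

          x≢q : x ≢ q
          x≢q refl = q∉ x∈M⁺

          y∉B : y ∉ B
          y∉B = disjoint t y y∈A

          x∉P : x ∉ P
          x∉P x∈P = x≢q (proj₁ (only t′ x v x∈P (right t′) (symm H (keep-edge G M⁺ v∉ vx))))

          uncrossed : x ∉ Q → ⊥
          uncrossed x∉Q = far-sides-disjoint robust t
            (Tight-sym (add-edge (remove-edge G x y M) (λ (i , _) → x∉P i) (λ (_ , i) → x∉Q i) t′))
            x≢q (symm G′ (keep-edge G M (free v∉) vx)) (keep-edge G M (free v∉) vq) (above-G′ (free v∉)) y y∈A y∈P

          crossed : x ∈ Q → ⊥
          crossed x∈Q = loose (B ∪ Q) (A ∩ P) record
            { left = x∈p∪q⁺ {p = B} (inj₂ x∈Q) ; right = x∈p∩q⁺ (y∈A , y∈P)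
            ; disjoint = λ w i j → let a , c = x∈p∩q⁻ A P j in
                [ disjoint t w a , disjoint t′ w c ]′ (x∈p∪q⁻ B Q i)
            ; only = only′ ; large = large′ }
            where
            only′ : ∀ b c → b ∈ B ∪ Q → c ∈ A ∩ P → Adj G′ b c → b ≡ x × c ≡ y
            only′ b c i j e with x∈p∩q⁻ A P j
            ... | c∈A , c∈P with x∈p∪q⁻ B Q i
            ... | inj₁ b∈B = contradiction (subst (_∈ P) (proj₁ (only t c b c∈A b∈B (symm G′ e))) c∈P) x∉P
            ... | inj₂ b∈Q with remove-edge G x y M b c e
            ...   | inj₂ (inj₁ s) = s
            ...   | inj₂ (inj₂ (refl , refl)) = contradiction c∈P x∉P
            ...   | inj₁ e′ with only t′ c b c∈P b∈Q (symm H e′)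
            ...     | refl , refl = contradiction (sym (proj₁ (only t q v c∈A (right t) (symm G′ e)))) x≢q
            corner : ∣ B ∩ Q ∣ + ∣ A ∪ P ∣ + k ≤ suc n
            corner = star-cut robust {x} {v} {q} (A ∪ P) (B ∩ Q) (x∈p∩q⁺ (right t , right t′)) (x , x∈p∪q⁺ (inj₁ (left t)))
              (λ w i j → let b , c = x∈p∩q⁻ B Q i in
                [ (λ a → disjoint t w a b) , (λ d → disjoint t′ w d c) ]′ (x∈p∪q⁻ A P j))
              edges (above-G′ (free v∉))
              where
              edges : ∀ b c → b ∈ B ∩ Q → c ∈ A ∪ P → Adj G′ b c → b ≡ v × (c ≡ x ⊎ c ≡ q)
              edges b c i j e with x∈p∩q⁻ B Q i
              ... | b∈B , b∈Q with x∈p∪q⁻ A P j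
              ... | inj₁ c∈A = let r , s = only t c b c∈A b∈B (symm G′ e) in s , inj₁ r
              ... | inj₂ c∈P with remove-edge G x y M b c e
              ...   | inj₁ e′ = let r , s = only t′ c b c∈P b∈Q (symm H e′) in s , inj₂ r
              ...   | inj₂ (inj₁ (refl , refl)) = contradiction b∈B (disjoint t b (left t))
              ...   | inj₂ (inj₂ (refl , refl)) = contradiction b∈B y∉B
            large′ : suc n ≤ ∣ B ∪ Q ∣ + ∣ A ∩ P ∣ + k
            large′ = arith (∣ A ∣) (∣ B ∣) (∣ P ∣) (∣ Q ∣) (∣ B ∩ Q ∣) (∣ B ∪ Q ∣) (∣ A ∩ P ∣) (∣ A ∪ P ∣)
                       (∪-∩-size B Q) (∪-∩-size A P) (large t) (large t′) corner
              where
              arith : ∀ a b c d bd b∪d ac a∪c → b∪d + bd ≡ b + d → a∪c + ac ≡ a + c → suc n ≤ a + b + k →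
                      suc n ≤ c + d + k → bd + a∪c + k ≤ suc n → suc n ≤ b∪d + ac + k
              arith a b c d bd b∪d ac a∪c e₁ e₂ h₁ h₂ h₃ = ≤-from (+-mono-≤ (+-mono-≤ h₁ h₂) h₃)
                (trans (cong (suc n +_) (cong (_+ suc n) eq₂)) (eq₃ n (bd + a∪c + k) (b∪d + ac + k)))
                where
                r₁ : ∀ a b c d k → (a + b + k) + (c + d + k) ≡ (a + c) + (b + d) + 2 * k
                r₁ a b c d k = linear 6 (λ a b c d k o → (((a ⊕ b) ⊕ k) ⊕ ((c ⊕ d) ⊕ k)) ⊜ (((a ⊕ c) ⊕ (b ⊕ d)) ⊕ (k ⊕ (k ⊕ unit)))) refl a b c d k 1
                r₂ : ∀ p q r s k → (s + r) + (q + p) + 2 * k ≡ (p + s + k) + (q + r + k)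
                r₂ p q r s k = linear 6 (λ p q r s k o → (((s ⊕ r) ⊕ (q ⊕ p)) ⊕ (k ⊕ (k ⊕ unit))) ⊜ (((p ⊕ s) ⊕ k) ⊕ ((q ⊕ r) ⊕ k))) refl p q r s k 1
                eq₂ : (a + b + k) + (c + d + k) ≡ (bd + a∪c + k) + (b∪d + ac + k)
                eq₂ = trans (r₁ a b c d k) (trans (cong₂ (λ p q → p + q + 2 * k) (sym e₂) (sym e₁)) (r₂ bd b∪d ac a∪c k))
                eq₃ : ∀ n p q → suc n + (p + q + suc n) ≡ q + (suc n + suc n + p)
                eq₃ n p q = linear 4 (λ n p q o → ((o ⊕ n) ⊕ ((p ⊕ q) ⊕ (o ⊕ n))) ⊜ (q ⊕ (((o ⊕ n) ⊕ (o ⊕ n)) ⊕ p))) refl n p q 1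

        -- The covered vertex that `v` misses can only be `y`, so `y` lies in the far side of a
        -- tight pair at `xv` and of one at `vq`. Both positions of `x` relative to `Q` are then
        -- impossible.
        loose-vx : Loose k G′ x y → Loose k G′ v x
        loose-vx loose B A t₀ =
          let t = Tight-sym t₀
              w , w∈A , w∈M , ¬vw = restored-obstacle v∉ vx t
              q , q∉ , vq = v-partner
              P , Q , t′ = inner-tight R q∉ v∉ (symm G vq)
              w′ , w′∈P , w′∈M , ¬vw′ = inner-obstacle R v∉ q∉ t′
              y∈A = subst (_∈ A) (missed-unique R (Tip.low v-tip) w∈M y∈M⁺ ¬vw ¬vy) w∈A
              y∈P = subst (_∈ P) (missed-unique R (Tip.low v-tip) w′∈M y∈M⁺ ¬vw′ ¬vy) w′∈P
              c = Crossed.crossed t y∈A q∉ vq t′ y∈P loose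
              d = Crossed.uncrossed t y∈A q∉ vq t′ y∈P loose
          in d c

        -- Exchanging xy for uy: if xy were tight, then x would have two neighbours among the vertices left over.
        M₃ : Edges n
        M₃ = (u , y) ∷ M

        R₃ : Max M₃
        R₃ = ((uy , free u∉ , y∉M , matching) , delete-edge (remove-edge G u y M) robust (Loose-sym (loose-y u-tip ux uy))) , proj₂ R

        -- Relative to `M₃`, the vertex `x` is a tip that sees both ends of the matching edge `uy`,
        -- and `loose-at-low` applies to it.
        loose-xy-of-tip : Tip M₃ x → Loose k G′ x y
        loose-xy-of-tip t = let tip x∉ low = Tip-flip M t in Loose-sym (AtEdge.loose-at-low (Max-flip R₃) x∉ low edge (symm G ux))

        U₃ = ∁ (covered M₃)

        U₃⁺ : ∀ {z} → z ∉ covered M₃ → z ∈ U₃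
        U₃⁺ = x∉p⇒x∈∁p

        U₃⁻ : ∀ {z} → z ∈ U₃ → z ∉ covered M₃
        U₃⁻ = x∈∁p⇒x∉p

        shift : ∀ {z} → z ∉ covered M⁺ → z ≢ u → z ∈ U₃
        shift z∉ z≢u = U₃⁺ (∉-covered⁺ {M = M} z≢u (≢-covered z∉ y∈M⁺) (free z∉))

        unshift : ∀ {z} → z ∈ U₃ → z ≢ x → z ∉ covered M⁺
        unshift i z≢x = let _ , z≢y , z∉M = ∉-covered⁻ {M = M} (U₃⁻ i) in ∉-covered⁺ {M = M} z≢x z≢y z∉M

        x∈U₃ : x ∈ U₃
        x∈U₃ = U₃⁺ (∉-covered⁺ {M = M} (λ e → ≢-covered u∉ x∈M⁺ (sym e)) x≢y x∉M)

        v∈U₃ : v ∈ U₃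
        v∈U₃ = shift v∉ (u≢v ∘ sym)

        module _ (¬tip : ¬ Tip M₃ x) where

          ≢x : ∀ {z} → Low U₃ z → z ≢ x
          ≢x low refl = ¬tip (tip (U₃⁻ x∈U₃) low)

          -- Passing from `M₃` back to `(x , y) ∷ M` uncovers only `u`; if `z` did not see `u`, it
          -- would be a third tip.
          near-u : ∀ {z} → z ∈ U₃ → z ≢ v → Low U₃ z → Adj G u z
          near-u {z} z∈ z≢v low = Dec.decidable-stable (adj? G u z) λ ¬uz →
            third z (tip (unshift z∈ (≢x low)) (≤-trans (∩-size-mono (nbhd G z) (∁ (covered M⁺)) {s = U₃}
              λ {b} i j → i , shift (x∈∁p⇒x∉p j) λ { refl → ¬uz (symm G (∈-nbhd⁻ G i)) }) low))
              (λ e → proj₁ (∉-covered⁻ {M = M} (U₃⁻ z∈)) e) z≢v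

          inner-u : ∀ {z} → Adj G u z → z ∉ covered M⁺ → z ∈ nbhd G u ∩ ∁ (covered M⁺)
          inner-u e z∉ = x∈p∩q⁺ (∈-nbhd⁺ G e , x∉p⇒x∈∁p z∉)

          u-unique : ∀ {z w} → Adj G u z → z ∉ covered M⁺ → Adj G u w → w ∉ covered M⁺ → z ≢ w → ⊥
          u-unique uz z∉ uw w∉ z≢w = <⇒≱ (≢-pair-size (inner-u uz z∉) (inner-u uw w∉) z≢w) (Tip.low u-tip)

          -- `v` already sees `x`, so its inner neighbour `q` must not belong to `U₃`, which leaves
          -- `q = u`.
          v-near-u : Low U₃ v → Adj G u v
          v-near-u low = let q , q∉ , vq = v-partner in
            Dec.decidable-stable (adj? G u v) λ ¬uv → <⇒≱ (≢-pair-size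
              (x∈p∩q⁺ (∈-nbhd⁺ G vx , x∈U₃))
              (x∈p∩q⁺ (∈-nbhd⁺ G vq , shift q∉ λ { refl → ¬uv (symm G vq) }))
              (λ e → ≢-covered q∉ x∈M⁺ (sym e))) low

          -- `U₃` has two low vertices, and both would be uncovered neighbours of the tip `u`.
          absurd : ⊥
          absurd =
            let free₃ = λ w i j → U₃⁻ i j
                z , z∈ , z≢v , low = low-vertex-other R₃ U₃ v free₃ (x , x∈U₃ , λ e → ≢-covered v∉ x∈M⁺ (sym e))
                z′ , z′∈ , z′≢z , low′ = low-vertex-other R₃ U₃ z free₃ (v , v∈U₃ , z≢v ∘ sym)
                uz = near-u z∈ z≢v low
                z∉ = unshift z∈ (≢x low)
                z′∉ = unshift z′∈ (≢x low′)
            in u-unique (near-u′ z′∈ low′) z′∉ uz z∉ z′≢z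
            where
            near-u′ : ∀ {z′} → z′ ∈ U₃ → Low U₃ z′ → Adj G u z′
            near-u′ {z′} i low′ with z′ ≟ v
            ... | yes refl = v-near-u low′
            ... | no z′≢v = near-u i z′≢v low′

        loose-xy : Loose k G′ x y
        loose-xy with ¬? (x ∈? covered M₃) ×-dec low? U₃ x
        ... | yes (x∉ , low) = loose-xy-of-tip (tip x∉ low)
        ... | no ¬tip = ⊥-elim (absurd λ (tip x∉ low) → ¬tip (x∉ , low))

      one-sided : ⊥
      one-sided = augment u∉ v∉ u≢v ux uy vx (Loose-sym (loose-y u-tip ux uy)) (loose-vx loose-xy)

  tip-degree : ∀ {M u w} → Max M → Low (∁ (covered M)) u → w ∈ covered M → ¬ Adj G u w → ∣ nbhd G u ∣ ≤ p + p
  tip-degree {M} {u} {w} R low w∈ ¬e = ≤-trans (p⊆q⇒∣p∣≤∣q∣ sub) (≤-trans (∪-size-≤ (nbhd G u ∩ ∁ (covered M)) (covered M - w))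
    (≤-trans (+-monoˡ-≤ _ low) (≤-trans (x∈p⇒∣p-x∣<∣p∣ w∈) (covered-≤ R))))
    where
    sub : nbhd G u ⊆ (nbhd G u ∩ ∁ (covered M)) ∪ (covered M - w)
    sub {v} i with v ∈? covered M
    ... | yes j = x∈p∪q⁺ {p = nbhd G u ∩ ∁ (covered M)} (inj₂ (x∈p∧x≢y⇒x∈p-y j λ { refl → ¬e (∈-nbhd⁻ G i) }))
    ... | no ¬j = x∈p∪q⁺ (inj₁ (x∈p∩q⁺ (i , x∉p⇒x∈∁p ¬j)))

  -- At least two vertices are uncovered, and they span a forest.
  two-tips : ∀ {M} → Max M → p + p + 2 ≤ n → ∃₂ λ u v → Tip M u × Tip M v × u ≢ v
  two-tips {M} R h =
    let U = ∁ (covered M)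
        free = λ w i j → x∈∁p⇒x∉p i j
        big : 2 ≤ ∣ U ∣
        big = +-cancelˡ-≤ (∣ covered M ∣) 2 (∣ U ∣) (≤-trans (+-monoˡ-≤ 2 (covered-≤ R)) (≤-trans h (≤-reflexive (sym (∁-size (covered M))))))
        u , u∈ , low = low-vertex R U (size-nonempty (≤-trans (s≤s z≤n) big)) free
        w , w∈ , w≢u = another big u
        v , v∈ , v≢u , low′ = low-vertex-other R U u free (w , w∈ , w≢u)
    in u , v , tip (x∈∁p⇒x∉p u∈) low , tip (x∈∁p⇒x∉p v∈) low′ , v≢u ∘ sym

  -- Contradictions from two tips

  module _ {x y x′ y′ : Fin n} {M : Edges n} (R : Max ((x , y) ∷ (x′ , y′) ∷ M)) where
    private
      M⁺ : Edges n
      M⁺ = (x , y) ∷ (x′ , y′) ∷ M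
      x∈ = left-covered {x = x} {y} {(x′ , y′) ∷ M}
      y∈ = right-covered {x = x} {y} {(x′ , y′) ∷ M}
      x′∈ = tail-covered {x = x} {y} {(x′ , y′) ∷ M} (left-covered {x = x′} {y′} {M})
      y′∈ = tail-covered {x = x} {y} {(x′ , y′) ∷ M} (right-covered {x = x′} {y′} {M})
      x≁ = ∉-covered⁻ {M = M} (AtEdge.x∉M R)
      y≁ = ∉-covered⁻ {M = M} (AtEdge.y∉M R)

    misses-one : ∀ {u w w′} → Tip M⁺ u → w ∈ covered M⁺ → w′ ∈ covered M⁺ → w ≢ w′ → ¬ Adj G u w → Adj G u w′
    misses-one {u} {w} {w′} t w∈ w′∈ w≢w′ ¬e = Dec.decidable-stable (adj? G u w′) λ ¬e′ →
      w≢w′ (missed-unique R (Tip.low t) w∈ w′∈ ¬e ¬e′)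

    -- If `z` sees `x` and `y`, it pairs up with `u` at that edge. Otherwise its one missed vertex
    -- is used up there, so `z` and `v` both see `x′` and `y′`.
    third-tip : ∀ {u v z} → Tip M⁺ u → Tip M⁺ v → Tip M⁺ z → u ≢ z → v ≢ z → Adj G u x → Adj G u y →
                ∀ {w} → w ∈ covered M⁺ → ¬ Adj G v w → w ≢ x′ → w ≢ y′ → ⊥
    third-tip {u} {v} {z} u-tip v-tip z-tip u≢z v≢z ux uy w∈ ¬vw w≢x′ w≢y′ with adj? G z x | adj? G z y
    ... | yes zx | yes zy = AtTips.two-sided R u-tip z-tip u≢z ux uy zx zy
    ... | no ¬zx | _ = AtTips.two-sided (Max-swap R) (Tip-swap M v-tip) (Tip-swap M z-tip) v≢z
          (misses-one v-tip w∈ x′∈ w≢x′ ¬vw) (misses-one v-tip w∈ y′∈ w≢y′ ¬vw)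
          (misses-one z-tip x∈ x′∈ (proj₁ x≁) ¬zx) (misses-one z-tip x∈ y′∈ (proj₁ (proj₂ x≁)) ¬zx)
    ... | yes _ | no ¬zy = AtTips.two-sided (Max-swap R) (Tip-swap M v-tip) (Tip-swap M z-tip) v≢z
          (misses-one v-tip w∈ x′∈ w≢x′ ¬vw) (misses-one v-tip w∈ y′∈ w≢y′ ¬vw)
          (misses-one z-tip y∈ x′∈ (proj₁ y≁) ¬zy) (misses-one z-tip y∈ y′∈ (proj₁ (proj₂ y≁)) ¬zy)

    two-edges : ∀ {u v} → Tip M⁺ u → Tip M⁺ v → u ≢ v → Adj G u x → Adj G u y → ⊥
    two-edges {u} {v} u-tip v-tip u≢v ux uy with adj? G v x | adj? G v y
    ... | yes vx | yes vy = AtTips.two-sided R u-tip v-tip u≢v ux uy vx vy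
    ... | yes vx | no ¬vy = AtTips.OneSided.one-sided R u-tip v-tip u≢v ux uy vx ¬vy λ z z-tip z≢u z≢v →
          third-tip u-tip v-tip z-tip (z≢u ∘ sym) (z≢v ∘ sym) ux uy y∈ ¬vy (proj₁ y≁) (proj₁ (proj₂ y≁))
    ... | no ¬vx | yes vy = AtTips.OneSided.one-sided (Max-flip R) (flip u-tip) (flip v-tip) u≢v uy ux vy ¬vx λ z z-tip z≢u z≢v →
          third-tip u-tip v-tip (Tip-flip ((x′ , y′) ∷ M) z-tip) (z≢u ∘ sym) (z≢v ∘ sym) ux uy x∈ ¬vx (proj₁ x≁) (proj₁ (proj₂ x≁))
      where
      flip : ∀ {z} → Tip M⁺ z → Tip ((y , x) ∷ (x′ , y′) ∷ M) z
      flip = Tip-flip ((x′ , y′) ∷ M)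
    -- A tip misses at most one covered vertex, so `x` and `y` would coincide.
    ... | no ¬vx | no ¬vy = irrefl G (subst (Adj G x) (sym (missed-unique R (Tip.low v-tip) x∈ y∈ ¬vx ¬vy)) (AtEdge.edge R))

    sees-an-edge : ∀ {u} → Tip M⁺ u → Adj G u x × Adj G u y ⊎ Adj G u x′ × Adj G u y′
    sees-an-edge {u} u-tip with adj? G u x | adj? G u y
    ... | yes ux | yes uy = inj₁ (ux , uy)
    ... | no ¬ux | _      = inj₂ (misses-one u-tip x∈ x′∈ (proj₁ x≁) ¬ux , misses-one u-tip x∈ y′∈ (proj₁ (proj₂ x≁)) ¬ux)
    ... | yes _  | no ¬uy = inj₂ (misses-one u-tip y∈ x′∈ (proj₁ y≁) ¬uy , misses-one u-tip y∈ y′∈ (proj₁ (proj₂ y≁)) ¬uy)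

  two-edges-absurd : ∀ {x y x′ y′ M} → Max ((x , y) ∷ (x′ , y′) ∷ M) → p + p + 2 ≤ n → ⊥
  two-edges-absurd {M = M} R h =
    let u , v , u-tip , v-tip , u≢v = two-tips R h
    in [ (λ (ux , uy) → two-edges R u-tip v-tip u≢v ux uy)
       , (λ (ux′ , uy′) → two-edges (Max-swap R) (Tip-swap M u-tip) (Tip-swap M v-tip) u≢v ux′ uy′) ]′
       (sees-an-edge R u-tip)

  -- Every degree exceeds `k ≥ 2p`, but by `tip-degree` a tip that misses a covered vertex has
  -- degree at most `2p`.
  wide-absurd : ∀ {x y M} → Max ((x , y) ∷ M) → p + p + 2 ≤ n → p + p ≤ k → ⊥
  wide-absurd {x} {y} {M} R h le =
    let u , v , u-tip , v-tip , u≢v = two-tips R h in AtTips.two-sided R u-tip v-tip u≢v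
        (sees u-tip (left-covered {M = M})) (sees u-tip (right-covered {M = M}))
        (sees v-tip (left-covered {M = M})) (sees v-tip (right-covered {M = M}))
    where
    sees : ∀ {z w} → Tip ((x , y) ∷ M) z → w ∈ covered ((x , y) ∷ M) → Adj G z w
    sees {z} {w} t w∈ = Dec.decidable-stable (adj? G z w) λ ¬e →
      <⇒≱ (above z) (≤-trans (tip-degree R (Tip.low t) w∈ ¬e) le)

-- The case k = 1, m = 2: longest paths and cycles

module LongestPath {n : ℕ} (G : Graph (Fin n)) (I : Inseparable 1 G) (two : ∀ v → 2 ≤ ∣ nbhd G v ∣)
  (none : ¬ ∃ λ M → Removable 1 G M × size M ≡ 2) where

  -- `r` counts edges; `at` is constrained only at indices up to `r`.
  record Path (r : ℕ) : Set where
    field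
      at   : ℕ → Fin n
      inj  : ∀ i j → i ≤ r → j ≤ r → at i ≡ at j → i ≡ j
      step : ∀ i → i < r → Adj G (at i) (at (suc i))

  open Path

  reverse : ∀ {r} → Path r → Path r
  reverse {r} P = record
    { at   = λ i → at P (r ∸ i)
    ; inj  = λ i j i≤ j≤ e → ∸-cancelˡ-≡ i≤ j≤ (inj P _ _ (m∸n≤m r i) (m∸n≤m r j) e)
    ; step = λ i i<r → symm G (subst (λ z → Adj G (at P (r ∸ suc i)) (at P z)) (sym (+-∸-assoc 1 i<r))
               (step P (r ∸ suc i) (≤-trans (≤-reflexive (sym (+-∸-assoc 1 i<r))) (m∸n≤m r i)))) }

  cons : ∀ {r} (P : Path r) w → Adj G w (at P 0) → (∀ i → i ≤ r → at P i ≢ w) → Path (suc r)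
  cons {r} P w e new = record { at = at′ ; inj = inj′ ; step = step′ }
    where
    at′ : ℕ → Fin n
    at′ zero    = w
    at′ (suc i) = at P i
    inj′ : ∀ i j → i ≤ suc r → j ≤ suc r → at′ i ≡ at′ j → i ≡ j
    inj′ zero    zero    _ _ _ = refl
    inj′ zero    (suc j) _ (s≤s j≤) eq = contradiction (sym eq) (new j j≤)
    inj′ (suc i) zero    (s≤s i≤) _ eq = contradiction eq (new i i≤)
    inj′ (suc i) (suc j) (s≤s i≤) (s≤s j≤) eq = cong suc (inj P i j i≤ j≤ eq)
    step′ : ∀ i → i < suc r → Adj G (at′ i) (at′ (suc i))
    step′ zero    _        = e
    step′ (suc i) (s≤s i<) = step P i i<

  module _ {H : Graph (Fin n)} where

    star-on : ∀ {S : Subset n} {u v} → (∀ a b → Adj G a b → Star (Adj H) a b) →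
              Star (Adj (G -ᵛ S)) u v → Star (Adj H) (proj₁ u) (proj₁ v)
    star-on f ε = ε
    star-on f (e ◅ es) = f _ _ e ◅◅ star-on f es

    star-off : ∀ {S : Subset n} (off : ∀ v → v ∉ S) {u v} → Star (Adj H) u v → Star (Adj (H -ᵛ S)) (u , off u) (v , off v)
    star-off off ε = ε
    star-off off (e ◅ es) = e ◅ star-off off es

    -- For `k = 1` only the empty set is deleted, so it is enough to replace each edge of a walk in
    -- `G` by a walk in `H`.
    rerouted : (∀ a b → Adj G a b → Star (Adj H) a b) → Inseparable 1 H
    rerouted f = connected⇒inseparable (order I , λ S small u v →
      let off = λ w i → <⇒≱ small (∈-size i)
      in star-off off {proj₁ u} {proj₁ v} (star-on f (proj₂ (inseparable⇒connected I) ∅ˢ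
           (≤-reflexive (cong suc (∣⊥∣≡0 n))) (proj₁ u , ∉⊥) (proj₁ v , ∉⊥))))

  -- Without the two end edges, the middle of the path still hangs together, and each end vertex
  -- remains attached through its other edge.
  ear-absurd : ∀ {s} (P : Path (suc s)) i j → 2 ≤ i → i ≤ s → Adj G (at P 0) (at P i) →
               j < s → Adj G (at P (suc s)) (at P j) → ⊥
  ear-absurd {s} P i j 2≤i i≤s e₀ j<s eᵣ = none (M ,
      ((step P 0 (s≤s z≤n) , ∉-covered⁺ {M = []} (apart 0 s 0≤ s≤ 0≢s) (apart 0 (suc s) 0≤ ≤-refl λ ()) ∉⊥
                           , ∉-covered⁺ {M = []} (apart 1 s 1≤ s≤ 1≢s) (apart 1 (suc s) 1≤ ≤-refl (0≢s ∘ suc-injective)) ∉⊥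
                           , step P s ≤-refl , ∉⊥ , ∉⊥ , tt) , rerouted route) , refl)
    where
    f = at P

    M : Edges n
    M = (f 0 , f 1) ∷ (f s , f (suc s)) ∷ []

    H : Graph (Fin n)
    H = G -ᵉ M

    2≤s : 2 ≤ s
    2≤s = ≤-trans 2≤i i≤s

    0≢s : 0 ≢ s
    0≢s eq = contradiction (subst (2 ≤_) (sym eq) 2≤s) λ ()

    1≢s : 1 ≢ s
    1≢s eq = contradiction (subst (2 ≤_) (sym eq) 2≤s) λ { (s≤s ()) }

    0≤ : 0 ≤ suc s
    0≤ = z≤n
    1≤ : 1 ≤ suc s
    1≤ = s≤s z≤n
    s≤ : s ≤ suc s
    s≤ = n≤1+n s

    apart : ∀ a b → a ≤ suc s → b ≤ suc s → a ≢ b → f a ≢ f b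
    apart a b a≤ b≤ a≢b e = a≢b (inj P a b a≤ b≤ e)

    same : ∀ {a b c d} → a ≤ suc s → b ≤ suc s → c ≤ suc s → d ≤ suc s → Same (f a) (f b) (f c) (f d) → Same a b c d
    same a≤ b≤ c≤ d≤ (inj₁ (p , q)) = inj₁ (inj P _ _ c≤ a≤ p , inj P _ _ d≤ b≤ q)
    same a≤ b≤ c≤ d≤ (inj₂ (p , q)) = inj₂ (inj P _ _ c≤ b≤ p , inj P _ _ d≤ a≤ q)

    split : ∀ u v → Adj G u v → Adj H u v ⊎ Same (f 0) (f 1) u v ⊎ Same (f s) (f (suc s)) u v
    split u v e with remove-edge G (f s) (f (suc s)) [] u v (e , λ { (inj₁ ()) ; (inj₂ ()) })
    ... | inj₂ q = inj₂ (inj₂ q)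
    ... | inj₁ e′ with remove-edge G (f 0) (f 1) _ u v e′
    ...   | inj₁ e″ = inj₁ e″
    ...   | inj₂ q  = inj₂ (inj₁ q)

    kept : ∀ a b → a ≤ suc s → b ≤ suc s → Adj G (f a) (f b) → ¬ Same 0 1 a b → ¬ Same s (suc s) a b → Adj H (f a) (f b)
    kept a b a≤ b≤ e ¬p ¬q with split (f a) (f b) e
    ... | inj₁ h = h
    ... | inj₂ (inj₁ p) = contradiction (same 0≤ 1≤ a≤ b≤ p) ¬p
    ... | inj₂ (inj₂ q) = contradiction (same s≤ ≤-refl a≤ b≤ q) ¬q

    climb : ∀ {a b} → 1 ≤ a → a ≤′ b → b ≤ s → Star (Adj H) (f a) (f b)
    climb 1≤a ≤′-refl _ = ε
    climb {a} 1≤a (≤′-step {b} l) b<s = climb 1≤a l (<⇒≤ b<s) ◅◅ (kept b (suc b) (m≤n⇒m≤1+n (<⇒≤ b<s)) (m≤n⇒m≤1+n b<s)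
        (step P b (m≤n⇒m≤1+n b<s))
        (λ { (inj₁ (p , _)) → b≢0 p ; (inj₂ (_ , ())) })
        (λ { (inj₁ (p , _)) → <-irrefl p b<s ; (inj₂ (p , _)) → <-irrefl p (≤-trans b<s s≤) }) ◅ ε)
      where
      b≢0 : b ≢ 0
      b≢0 eq = contradiction (subst (1 ≤_) eq (≤-trans 1≤a (≤′⇒≤ l))) λ ()

    start : Adj H (f 0) (f i)
    start = kept 0 i 0≤ (≤-trans i≤s s≤) e₀
      (λ { (inj₁ (_ , refl)) → contradiction 2≤i λ { (s≤s ()) } ; (inj₂ (() , _)) })
      (λ { (inj₁ (p , _)) → 0≢s p ; (inj₂ (() , _)) })

    end : Adj H (f (suc s)) (f j)
    end = kept (suc s) j ≤-refl (≤-trans (<⇒≤ j<s) s≤) eᵣ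
      (λ { (inj₁ (() , _)) ; (inj₂ (p , _)) → 0≢s (sym (suc-injective p)) })
      (λ { (inj₁ (p , _)) → 1+n≢n p ; (inj₂ (_ , p)) → <-irrefl p j<s })

    1≤i : 1 ≤ i
    1≤i = ≤-trans (s≤s z≤n) 2≤i

    flip : ∀ {u v} → Star (Adj H) u v → Star (Adj H) v u
    flip = Star-reverse (symm H)

    route₀ : Star (Adj H) (f 0) (f 1)
    route₀ = start ◅ flip (climb ≤-refl (≤⇒≤′ 1≤i) i≤s)

    routeⱼ : ∀ j → j < s → Star (Adj H) (f j) (f s)
    -- The last vertex may be attached to the first one, whose own way back goes through `f i`.
    routeⱼ zero    _   = start ◅ climb 1≤i (≤⇒≤′ i≤s) ≤-refl
    routeⱼ (suc j) j<s = climb (s≤s z≤n) (≤⇒≤′ (<⇒≤ j<s)) ≤-refl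

    routeᵣ : Star (Adj H) (f (suc s)) (f s)
    routeᵣ = end ◅ routeⱼ j j<s

    route : ∀ a b → Adj G a b → Star (Adj H) a b
    route a b e with split a b e
    ... | inj₁ h = h ◅ ε
    ... | inj₂ (inj₁ (inj₁ (refl , refl))) = route₀
    ... | inj₂ (inj₁ (inj₂ (refl , refl))) = flip route₀
    ... | inj₂ (inj₂ (inj₁ (refl , refl))) = flip routeᵣ
    ... | inj₂ (inj₂ (inj₂ (refl , refl))) = routeᵣ

  -- The vertices of the cycle are at 0, …, at r; continuing periodically makes a rotation a shift of the index.
  record Closed (r : ℕ) : Set where
    field
      at     : ℕ → Fin n
      period : ∀ i → at (i + suc r) ≡ at i
      inj    : ∀ i j → i ≤ r → j ≤ r → at i ≡ at j → i ≡ j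
      step   : ∀ i → Adj G (at i) (at (suc i))

  module Cyc = Closed

  rotate : ∀ {r} → Closed r → Closed r
  rotate {r} c = record
    { at     = at′ ∘ suc
    ; period = λ i → Cyc.period c (suc i)
    ; inj    = inj′
    ; step   = Cyc.step c ∘ suc }
    where
    at′ = Cyc.at c
    wrap : ∀ {i} → i ≡ r → at′ (suc i) ≡ at′ 0
    wrap refl = Cyc.period c 0
    inj′ : ∀ i j → i ≤ r → j ≤ r → at′ (suc i) ≡ at′ (suc j) → i ≡ j
    inj′ i j i≤ j≤ e with m≤n⇒m<n∨m≡n i≤ | m≤n⇒m<n∨m≡n j≤
    ... | inj₁ i< | inj₁ j< = suc-injective (Cyc.inj c (suc i) (suc j) i< j< e)
    ... | inj₁ i< | inj₂ j≡ = contradiction (Cyc.inj c (suc i) 0 i< z≤n (trans e (wrap j≡))) λ ()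
    ... | inj₂ i≡ | inj₁ j< = contradiction (Cyc.inj c 0 (suc j) z≤n j< (trans (sym (wrap i≡)) e)) λ ()
    ... | inj₂ i≡ | inj₂ j≡ = trans i≡ (sym j≡)

  rotateN : ∀ {r} → ℕ → Closed r → Closed r
  rotateN zero    c = c
  rotateN (suc a) c = rotateN a (rotate c)

  at-rotateN : ∀ {r} a (c : Closed r) i → Cyc.at (rotateN a c) i ≡ Cyc.at c (a + i)
  at-rotateN zero    c i = refl
  at-rotateN (suc a) c i = at-rotateN a (rotate c) i

  unclose : ∀ {r} → Closed r → Path r
  unclose c = record { at = Cyc.at c ; inj = Cyc.inj c ; step = λ i _ → Cyc.step c i }

  close : ∀ {r} (P : Path r) → Adj G (at P r) (at P 0) → Closed r
  close {r} P e = record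
    { at     = λ i → at P (i % suc r)
    ; period = λ i → cong (at P) ([m+n]%n≡m%n i (suc r))
    ; inj    = λ i j i≤ j≤ eq → inj P i j i≤ j≤ (subst₂ _≡_ (cong (at P) (m<n⇒m%n≡m (s≤s i≤))) (cong (at P) (m<n⇒m%n≡m (s≤s j≤))) eq)
    ; step   = λ i → step′ (i % suc r) (m%n<n i (suc r)) (trans (cong (λ z → suc z % suc r) (m≡m%n+[m/n]*n i (suc r))) ([m+kn]%n≡m%n (suc (i % suc r)) (i / suc r) (suc r))) }
    where
    step′ : ∀ m → m < suc r → ∀ {l} → l ≡ suc m % suc r → Adj G (at P m) (at P l)
    step′ m (s≤s m≤) eq with m≤n⇒m<n∨m≡n m≤
    ... | inj₁ m<r = subst (λ z → Adj G (at P m) (at P z)) (sym (trans eq (m<n⇒m%n≡m (s≤s m<r)))) (step P m m<r)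
    ... | inj₂ refl = subst (λ z → Adj G (at P m) (at P z)) (sym (trans eq (n%n≡0 (suc r)))) e

  at-mod : ∀ {r} (c : Closed r) i → Cyc.at c (i % suc r) ≡ Cyc.at c i
  at-mod {r} c i = sym (trans (cong (Cyc.at c) (m≡m%n+[m/n]*n i (suc r))) (go (i / suc r)))
    where
    go : ∀ q → Cyc.at c (i % suc r + q * suc r) ≡ Cyc.at c (i % suc r)
    go zero    = cong (Cyc.at c) (+-identityʳ _)
    go (suc q) = trans (cong (Cyc.at c) (trans (cong (i % suc r +_) (+-comm (suc r) (q * suc r))) (sym (+-assoc (i % suc r) (q * suc r) (suc r)))))
                   (trans (Cyc.period c _) (go q))

  module Ring {r : ℕ} (c : Closed (2 + r))
    (enclosed : ∀ i w → Adj G (Cyc.at c i) w → ∃ λ j → j ≤ 2 + r × Cyc.at c j ≡ w) where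

    private f = Cyc.at c

    -- No edge leaves the cycle, so a vertex off it would contradict connectedness.
    index : ∀ v → ∃ λ j → j ≤ 2 + r × f j ≡ v
    index v with any? (λ i → f (toℕ {3 + r} i) ≟ v)
    ... | yes (i , e) = toℕ i , s≤s⁻¹ (toℕ<n i) , e
    ... | no ¬i = ⊥-elim (<⇒≱ (≤-reflexive (trans (cong suc (sym (∁-size On))) (+-comm 1 _)))
                   (cut I On (∁ On) (f 0 , on 0 z≤n) (v , x∉p⇒x∈∁p λ i → let i′ , e = ∈-comprehension⁻ on? i in ¬i (i′ , e))
                     (λ w i j → x∈∁p⇒x∉p j i)
                     λ u w i j e → let i′ , eq = ∈-comprehension⁻ on? i
                                       l , l≤ , eq′ = enclosed (toℕ i′) w (subst (λ z → Adj G z w) (sym eq) e)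
                                   in x∈∁p⇒x∉p j (subst (_∈ On) eq′ (on l l≤))))
      where
      on? : Decidable (λ w → ∃ λ (i : Fin (3 + r)) → f (toℕ i) ≡ w)
      on? w = any? λ i → f (toℕ i) ≟ w
      On = comprehension on?
      on : ∀ i → i ≤ 2 + r → f i ∈ On
      on i i≤ = ∈-comprehension⁺ on? (fromℕ< (s≤s i≤) , cong f (toℕ-fromℕ< (s≤s i≤)))

    -- Cutting the cycle open before `0` gives a path whose ends are adjacent; a chord at `0` is
    -- then excluded by `ear-absurd`.
    beside-0 : ∀ (d : Closed (2 + r)) (i : ℕ) → i ≤ 2 + r → Adj G (Cyc.at d 0) (Cyc.at d i) → i ≡ 1 ⊎ i ≡ 2 + r
    beside-0 d zero _ e = contradiction e (irrefl G)
    beside-0 d (suc zero) _ e = inj₁ refl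
    beside-0 d (suc (suc i)) (s≤s (s≤s i≤)) e with m≤n⇒m<n∨m≡n i≤
    ... | inj₂ refl = inj₂ refl
    ... | inj₁ i<r = ⊥-elim (ear-absurd (unclose d) (2 + i) 0 (s≤s (s≤s z≤n)) (s≤s i<r) e (s≤s z≤n)
                       (subst (Adj G _) (Cyc.period d 0) (Cyc.step d (2 + r))))

    next : ∀ a b → b ≤ 2 + r → f b ≡ f (suc a) → b ≡ suc a % (3 + r)
    next a b b≤ e = Cyc.inj c b _ b≤ (s≤s⁻¹ (m%n<n (suc a) (3 + r))) (trans e (sym (at-mod c (suc a))))

    beside : ∀ a b → a ≤ 2 + r → b ≤ 2 + r → Adj G (f a) (f b) → b ≡ suc a % (3 + r) ⊎ a ≡ suc b % (3 + r)
    beside a b a≤ b≤ e = [ (λ i≡ → inj₁ (next a b b≤ (trans (sym g-i) (trans (cong (Cyc.at g) i≡) (trans (at-rotateN a c 1) (cong f (+-comm a 1)))))))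
                         , (λ i≡ → inj₂ (prev a a≤ (trans (sym g-i) (trans (cong (Cyc.at g) i≡) (at-rotateN a c (2 + r)))))) ]′
        (beside-0 g i i≤ (subst₂ (Adj G) (sym (trans (at-rotateN a c 0) (cong f (+-identityʳ a)))) (sym g-i) e))
      where
      g = rotateN a c
      hit : ∀ a b → ∃ λ i → i ≤ 2 + r × Cyc.at (rotateN a c) i ≡ f b
      -- This is `b - a` modulo `3 + r`, since `2 + r` is congruent to `-1`.
      hit a b = (b + a * (2 + r)) % (3 + r) , s≤s⁻¹ (m%n<n (b + a * (2 + r)) (3 + r)) , trans (at-mod (rotateN a c) _)
        (trans (at-rotateN a c _) (trans (cong f (eq a)) (turns a)))
        where
        eq : ∀ a → a + (b + a * (2 + r)) ≡ b + a * (3 + r)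
        eq a = trans (sym (+-assoc a b _)) (trans (cong (_+ a * (2 + r)) (+-comm a b)) (trans (+-assoc b a _)
                 (cong (b +_) (sym (*-suc a (2 + r))))))
        turns : ∀ a → f (b + a * (3 + r)) ≡ f b
        turns zero = cong f (+-identityʳ b)
        turns (suc a) = trans (cong f (trans (cong (b +_) (+-comm (3 + r) (a * (3 + r)))) (sym (+-assoc b _ (3 + r)))))
                          (trans (Cyc.period c _) (turns a))
      i = proj₁ (hit a b)
      i≤ = proj₁ (proj₂ (hit a b))
      g-i = proj₂ (proj₂ (hit a b))
      prev : ∀ a → a ≤ 2 + r → f b ≡ f (a + (2 + r)) → a ≡ suc b % (3 + r)
      prev zero a≤ e = sym (trans (cong (λ z → suc z % (3 + r)) (Cyc.inj c b (2 + r) b≤ ≤-refl e)) (n%n≡0 (3 + r)))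
      prev (suc a) a≤ e with Cyc.inj c b a b≤ (<⇒≤ a≤) (trans e (trans (cong f (sym (+-suc a (2 + r)))) (Cyc.period c a)))
      ... | refl = sym (m<n⇒m%n≡m (s≤s a≤))

    isCycle : IsCycle G
    isCycle = r , record
      { vertices = mk↔ₛ′ g (f ∘ toℕ) (λ i → toℕ-injective (Cyc.inj c _ _ (s≤s⁻¹ (toℕ<n _)) (s≤s⁻¹ (toℕ<n i)) (f-g (f (toℕ i))))) f-g
      ; adjacent = λ u v → mk⇔
          (λ e → beside (toℕ (g u)) (toℕ (g v)) (s≤s⁻¹ (toℕ<n _)) (s≤s⁻¹ (toℕ<n _)) (subst₂ (Adj G) (sym (f-g u)) (sym (f-g v)) e))
          λ { (inj₁ e) → forward u v e ; (inj₂ e) → symm G (forward v u e) } }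
      where
      g : Fin n → Fin (3 + r)
      g v = fromℕ< (s≤s (proj₁ (proj₂ (index v))))
      f-g : ∀ v → f (toℕ (g v)) ≡ v
      f-g v = trans (cong f (toℕ-fromℕ< (s≤s (proj₁ (proj₂ (index v)))))) (proj₂ (proj₂ (index v)))
      forward : ∀ u v → Next (g u) (g v) → Adj G u v
      forward u v e = subst₂ (Adj G) (f-g u) (trans (sym (at-mod c _)) (trans (cong f (sym e)) (f-g v))) (Cyc.step c (toℕ (g u)))

  on-path? : ∀ {r} (P : Path r) w → (∃ λ i → i ≤ r × at P i ≡ w) ⊎ (∀ i → i ≤ r → at P i ≢ w)
  on-path? {r} P w with any? (λ (i : Fin (suc r)) → at P (toℕ i) ≟ w)
  ... | yes (i , e) = inj₁ (toℕ i , s≤s⁻¹ (toℕ<n i) , e)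
  ... | no ¬i = inj₂ λ i i≤ e → ¬i (fromℕ< (s≤s i≤) , trans (cong (at P) (toℕ-fromℕ< (s≤s i≤))) e)

  -- If an edge leaves the cycle, rotating its end on the cycle to position `0` and cutting the
  -- cycle open gives a longer path.
  closed-progress : ∀ {r} → Closed (2 + r) → IsCycle G ⊎ Path (3 + r)
  closed-progress {r} c with any? (λ w → any? λ (i : Fin (3 + r)) → adj? G (Cyc.at c (toℕ i)) w ×-dec
                               all? λ (j : Fin (3 + r)) → ¬? (Cyc.at c (toℕ j) ≟ w))
  ... | yes (w , i , e , new) = inj₂ (cons (unclose (rotateN (toℕ i) c)) w
          (symm G (subst (λ z → Adj G z w) (sym (trans (at-rotateN (toℕ i) c 0) (cong (Cyc.at c) (+-identityʳ _)))) e))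
          λ j _ eq → fresh (toℕ i + j) (trans (sym (at-rotateN (toℕ i) c j)) eq))
    where
    fresh : ∀ m → Cyc.at c m ≢ w
    fresh m eq = new (fromℕ< (m%n<n m (3 + r))) (trans (cong (Cyc.at c) (toℕ-fromℕ< (m%n<n m (3 + r)))) (trans (at-mod c m) eq))
  ... | no ¬e = inj₁ (Ring.isCycle c enclosed)
    where
    enclosed : ∀ i w → Adj G (Cyc.at c i) w → ∃ λ j → j ≤ 2 + r × Cyc.at c j ≡ w
    enclosed i w e with on-path? (unclose c) w
    ... | inj₁ r = r
    ... | inj₂ off = ⊥-elim (¬e (w , fromℕ< i< , subst (λ z → Adj G z w)
            (sym (trans (cong (Cyc.at c) (toℕ-fromℕ< i<)) (at-mod c i))) e , λ j → off (toℕ j) (s≤s⁻¹ (toℕ<n j))))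
      where i< = m%n<n i (3 + r)

  ear : ∀ {r} (P : Path r) → Path (suc r) ⊎ (∃ λ i → 2 ≤ i × i ≤ r × Adj G (at P 0) (at P i))
  ear {r} P with another (two (at P 0)) (at P 1)
  ... | z , z∈ , z≢ with on-path? P z
  ... | inj₂ off = inj₁ (cons P z (symm G (∈-nbhd⁻ G z∈)) off)
  ... | inj₁ (zero , _ , refl) = contradiction (∈-nbhd⁻ G z∈) (irrefl G)
  ... | inj₁ (suc zero , _ , e) = contradiction (sym e) z≢
  ... | inj₁ (suc (suc i) , i≤ , refl) = inj₂ (2 + i , s≤s (s≤s z≤n) , i≤ , ∈-nbhd⁻ G z∈)

  progress : ∀ {r} → Path r → IsCycle G ⊎ Path (suc r)
  progress {r} P with ear P | ear (reverse P)
  ... | inj₁ Q | _ = inj₂ Q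
  ... | inj₂ _ | inj₁ Q = inj₂ Q
  progress {suc zero} P | inj₂ (i , 2≤i , i≤r , _) | _ = contradiction (≤-trans 2≤i i≤r) λ { (s≤s ()) }
  progress {zero} P | inj₂ (i , 2≤i , i≤r , _) | _ = contradiction (≤-trans 2≤i i≤r) λ ()
  progress {suc (suc r)} P | inj₂ (i , 2≤i , i≤r , e) | inj₂ (suc j , 2≤j , j≤r , e′) with m≤n⇒m<n∨m≡n i≤r
  ... | inj₂ refl = closed-progress (close P (symm G e))
  -- Position `suc j` of the reversed path is position `suc r ∸ j` of `P`.
  ... | inj₁ i<r = ⊥-elim (ear-absurd P i (suc r ∸ j) 2≤i (s≤s⁻¹ i<r) e (lt j (s≤s⁻¹ 2≤j) (s≤s⁻¹ j≤r)) e′)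
    where
    lt : ∀ j → 1 ≤ j → j ≤ suc r → suc r ∸ j < suc r
    lt (suc j) _ _ = s≤s (m∸n≤m r j)
  progress {suc (suc r)} P | inj₂ _ | inj₂ (zero , () , _)

  cycle : IsCycle G
  cycle = grow n (≤-reflexive (sym (+-identityʳ n))) (single (fromℕ< (order I)))
    where
    single : Fin n → Path 0
    single v = record { at = λ _ → v ; inj = λ { zero zero _ _ _ → refl } ; step = λ _ () }
    grow : ∀ fuel {r} → n ≤ fuel + r → Path r → IsCycle G
    grow zero {r} n≤r P = contradiction (injective⇒≤ {f = λ (i : Fin (suc r)) → at P (toℕ i)} λ {i} {j} e →
      toℕ-injective (inj P _ _ (s≤s⁻¹ (toℕ<n i)) (s≤s⁻¹ (toℕ<n j)) e)) (<⇒≱ (s≤s n≤r))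
    grow (suc fuel) {r} h P = [ id , grow fuel (≤-trans h (≤-reflexive (sym (+-suc fuel r)))) ]′ (progress P)

-- Growing the matching and combining the cases

augmentable : ∀ {n k s} {G : Graph (Fin n)} → 1 ≤ n → (∀ v → k < ∣ nbhd G v ∣) → (∀ v → 2 + (s + s) ≤ ∣ nbhd G v ∣) →
         (∃ λ M → Removable k G M × size M ≡ s) → ∃ λ M → Removable k G M × size M ≡ suc s
augmentable {n} {k} {s} {G} 1≤n above wide (M , R)
  with exists-of-size? (λ M → matching? G M ×-dec inseparable? k (G -ᵉ M)) (suc s)
... | yes r = r
... | no none = ⊥-elim (<⇒≱ (≤-trans (s≤s (s≤s covered-≤)) (wide u))
        (≤-trans (p⊆q⇒∣p∣≤∣q∣ sub) (≤-trans (∪-size-≤ (nbhd G u ∩ ∁ (covered M)) (covered M)) (+-monoˡ-≤ _ (proj₂ (proj₂ found))))))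
  where
  open Maximum G above (λ v → ≤-trans (m≤n+m (s + s) 2) (wide v)) none hiding (covered-≤)
  covered-≤ : ∣ covered M ∣ ≤ s + s
  covered-≤ = subst (λ z → ∣ covered M ∣ ≤ z + z) (proj₂ R) (covered-size M)
  U = ∁ (covered M)
  found : ∃ λ v → v ∈ U × Low U v
  found = low-vertex R U
    (size-nonempty (+-cancelˡ-≤ (∣ covered M ∣) 1 (∣ U ∣) (≤-trans (+-monoˡ-≤ 1 covered-≤)
       (≤-trans (≤-reflexive (+-comm (s + s) 1)) (≤-trans (n≤1+n _) (≤-trans (wide (fromℕ< 1≤n)) (≤-trans (∣p∣≤n (nbhd G (fromℕ< 1≤n)))
         (≤-reflexive (sym (∁-size (covered M)))))))))))
    (λ w i j → x∈∁p⇒x∉p i j)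
  u = proj₁ found
  sub : nbhd G u ⊆ (nbhd G u ∩ U) ∪ covered M
  sub {v} i with v ∈? covered M
  ... | yes j = x∈p∪q⁺ {p = nbhd G u ∩ U} (inj₂ j)
  ... | no ¬j = x∈p∪q⁺ (inj₁ (x∈p∩q⁺ (i , x∉p⇒x∈∁p ¬j)))

removable-of-size : ∀ {n k} {G : Graph (Fin n)} → Inseparable k G → (∀ v → k < ∣ nbhd G v ∣) →
                    ∀ s → (∀ v → s + s ≤ ∣ nbhd G v ∣) → ∃ λ M → Removable k G M × size M ≡ s
removable-of-size I above zero wide = [] , (tt , Inseparable-mono (λ u v e → e , λ { (inj₁ ()) ; (inj₂ ()) }) I) , refl
removable-of-size I above (suc s) wide = augmentable (≤-trans (s≤s z≤n) (order I)) above wide′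
    (removable-of-size I above s λ v → ≤-trans (m≤n+m (s + s) 2) (wide′ v))
  where
  wide′ : ∀ v → 2 + (s + s) ≤ _
  wide′ v = ≤-trans (≤-reflexive (cong suc (sym (+-suc s s)))) (wide v)

complete : ∀ {n r} {G : Graph (Fin n)} → n ≡ r → (∀ u v → u ≢ v → Adj G u v) → G ≅ K r
complete {G = G} refl f = record
  { vertices = mk↔ₛ′ id id (λ _ → refl) (λ _ → refl)
  ; adjacent = λ u v → mk⇔ (λ { e refl → irrefl G e }) (f u v) }

-- A vertex has at most `n - 1 ≤ 2p` possible neighbours and must see all of them.
small-complete : ∀ {n p} {G : Graph (Fin n)} → 1 ≤ n → (∀ v → p + p ≤ ∣ nbhd G v ∣) → n ≤ suc (p + p) →
                 n ≡ suc (p + p) × (∀ u v → u ≢ v → Adj G u v)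
small-complete {n} {p} {G} 1≤n wide n≤ = ≤-antisym n≤ (≤-trans (s≤s (wide v₀)) (≤-trans (s≤s (p⊆q⇒∣p∣≤∣q∣ (sub v₀))) (others v₀))) ,
  λ u v u≢v → Dec.decidable-stable (adj? G u v) λ ¬e → <⇒≱ (≤-trans (s≤s (p⊆q⇒∣p∣≤∣q∣ (sub′ u v ¬e)))
     (x∈p⇒∣p-x∣<∣p∣ (x∈p∧x≢y⇒x∈p-y ∈⊤ (u≢v ∘ sym)))) (≤-trans (s≤s⁻¹ (≤-trans (others u) n≤)) (wide u))
  where
  v₀ = fromℕ< 1≤n
  others : ∀ v → suc ∣ ⊤ˢ - v ∣ ≤ n
  others v = ≤-trans (x∈p⇒∣p-x∣<∣p∣ {x = v} ∈⊤) (∣p∣≤n ⊤ˢ)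
  sub : ∀ v → nbhd G v ⊆ ⊤ˢ - v
  sub v i = x∈p∧x≢y⇒x∈p-y ∈⊤ (adjacent-≢ G (∈-nbhd⁻ G i))
  sub′ : ∀ u v → ¬ Adj G u v → nbhd G u ⊆ (⊤ˢ - u) - v
  sub′ u v ¬e i = x∈p∧x≢y⇒x∈p-y (sub u i) λ { refl → ¬e (∈-nbhd⁻ G i) }

theorem1p3 : (k m : ℕ) → k ≥ 1 → m ≥ 1 →
    (n : ℕ) (G : Graph (Fin n)) → k -connected G →
    δ G ≥ (k + 1) ⊔ (2 * m ∸ 2) →
    (∃ λ M → (k -removable) G M × size M ≡ m)
      ⊎ (G ≅ K (2 * m ∸ 1))
      ⊎ (k ≡ 1 × m ≡ 2 × IsCycle G)
theorem1p3 k (suc p) k≥1 _ n G conn δ≥ with exists-of-size? (λ M → matching? G M ×-dec inseparable? k (G -ᵉ M)) (suc p)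
... | yes (M , (m , I) , s) = inj₁ (M , (Matching⇒IsMatching M m , inseparable⇒connected I) , s)
... | no none = inj₂ (exceptional p refl none (n ≤? suc (p + p)))
  where
  degree : ∀ v → (k + 1) ⊔ (2 * suc p ∸ 2) ≤ ∣ nbhd G v ∣
  degree v = subst (_ ≤_) (sym (nbhd-size G v)) (≤-trans δ≥ (All.lookup (min≤xs n (map (deg G) (allFin n))) (∈-map⁺ (deg G) (∈-allFin v))))

  above : ∀ v → k < ∣ nbhd G v ∣
  above v = ≤-trans (≤-reflexive (+-comm 1 k)) (≤-trans (m≤m⊔n (k + 1) _) (degree v))

  wide : ∀ v → p + p ≤ ∣ nbhd G v ∣
  wide v = ≤-trans (≤-reflexive (sym (trans (cong (_∸ 1) (+-suc p (p + 0))) (cong (p +_) (+-identityʳ p))))) (≤-trans (m≤n⊔m (k + 1) _) (degree v))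

  insep : Inseparable k G
  insep = connected⇒inseparable conn

  1≤n : 1 ≤ n
  1≤n = ≤-trans (s≤s z≤n) (order insep)

  roomy : ¬ n ≤ suc (p + p) → p + p + 2 ≤ n
  roomy ≰ = ≤-trans (≤-reflexive (+-comm (p + p) 2)) (≰⇒> ≰)

  -- Here `p = m - 1`; the copy `q` allows a case split on a value already fixed.
  exceptional : ∀ q → q ≡ p → ¬ (∃ λ M → Removable k G M × size M ≡ suc p) → Dec (n ≤ suc (p + p)) →
                (G ≅ K (2 * suc p ∸ 1)) ⊎ (k ≡ 1 × suc p ≡ 2 × IsCycle G)
  exceptional _ _ _ (yes n≤) = let n≡ , f = small-complete {p = p} {G = G} 1≤n wide n≤ in
    inj₁ (complete (trans n≡ (trans (sym (+-suc p p)) (cong (λ z → p + suc z) (sym (+-identityʳ p))))) f)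
  -- Degrees above `k ≥ 1` are at least 2, enough to enlarge the empty matching.
  exceptional zero refl none (no _) = contradiction (augmentable {s = 0} {G = G} 1≤n above (λ v → ≤-trans (s≤s k≥1) (above v))
    (removable-of-size {G = G} insep above 0 λ _ → z≤n)) none
  exceptional (suc zero) refl none (no ≰) with k ≟ℕ 1
  ... | yes refl = inj₂ (refl , refl , LongestPath.cycle G insep wide none)
  -- Now `k ≥ 2 = 2p`, as `wide-absurd` requires.
  ... | no k≢1 with removable-of-size insep above 1 wide
  ...   | (_ ∷ M) , R = ⊥-elim (Maximum.wide-absurd G above wide none R (roomy ≰) (≤∧≢⇒< k≥1 (k≢1 ∘ sym)))
  exceptional (suc (suc q)) refl none (no ≰) with removable-of-size insep above p wide
  ... | _ ∷ _ ∷ M , R = ⊥-elim (Maximum.two-edges-absurd G above wide none R (roomy ≰))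
  ... | [] , _ , ()
  ... | _ ∷ [] , _ , ()
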